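{- Let $n>4$ and let $W_n$ be the wheel graph on $n$ vertices. Then $B_3(W_n)=\left\lfloor \frac{n}{2}\right\rfloor+1$.
   Context: The wheel graph $W_n$ consists of a cycle on $n-1$ vertices (the outer cycle) together with one additional vertex (the hub) adjacent to every vertex of the cycle. A tile is a vertex together with a finite multiset of half-edges, each half-edge labeled by a cohesive-end symbol $a$ or its complement $\hat a$, where $a$ ranges over an alphabet of bond-edge types. A pot $P$ is a finite set of distinct tile types. A graph $G$ (loops and multiple edges allowed) is realized by $P$ if each vertex of $G$ can be assigned a copy of some tile type in $P$ (any number of copies of each type may be used) so that the half-edges at each vertex are in bijection with the edge-ends at that vertex and every edge of $G$ is formed by joining a half-edge labeled $a$ with a half-edge labeled $\hat a$ for some bond-edge type $a$, with no half-edge left unmatched. $C_{min}(P)$ is the set of graphs of minimum order among all graphs realized by $P$. In Scenario 3 a pot $P$ is admissible for a target graph $G$ if $C_{min}(P)=\{G\}$ up to isomorphism, i.e. $P$ realizes $G$, realizes no graph of smaller order, and realizes no graph of the same order nonisomorphic to $G$. $B_3(G)$ is the minimum number of bond-edge types over all pots admissible for $G$ in Scenario 3. -}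

module Defs where

open import Data.Nat using (ℕ; zero; suc; _+_; _≤_; _<_; _%_)
open import Data.Nat.DivMod using (m%n<n)
open import Data.Fin using (Fin; zero; suc; toℕ; fromℕ<; _↑ˡ_; _↑ʳ_; splitAt)
open import Data.Fin.Properties using (_≟_)
open import Data.Bool using (Bool; true; false; not; _∧_; _∨_; if_then_else_)
import Data.Bool.Properties as BoolP
open import Data.Sum using (_⊎_; inj₁; inj₂)
open import Data.Product using (Σ; _×_; _,_; proj₁; proj₂; ∃)
open import Relation.Nullary using (¬_)
open import Relation.Nullary.Decidable using (⌊_⌋)
open import Relation.Binary.PropositionalEquality using (_≡_; _≢_)
open import Function.Bundles using (_↔_; Inverse)

Σ[<_] : (m : ℕ) → (Fin m → ℕ) → ℕ
Σ[< zero ] f = 0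
Σ[< suc m ] f = f zero + Σ[< m ] (λ i → f (suc i))

ind : Bool → ℕ
ind b = if b then 1 else 0

-- Finite multigraphs (loops and multiple edges allowed).
-- Vertices are Fin order, edges are Fin size; each edge has two ends
-- (an unordered pair; the order of the two ends carries no meaning).

record Graph : Set where
  field
    order : ℕ
    size  : ℕ
    ends  : Fin size → Fin order × Fin order

open Graph public

-- number of edges joining u and v (a loop at u counts once in mult G u u)
mult : (G : Graph) → Fin (order G) → Fin (order G) → ℕ
mult G u v = Σ[< size G ] λ e →
  ind ((⌊ proj₁ (ends G e) ≟ u ⌋ ∧ ⌊ proj₂ (ends G e) ≟ v ⌋)
     ∨ (⌊ proj₁ (ends G e) ≟ v ⌋ ∧ ⌊ proj₂ (ends G e) ≟ u ⌋))

_≅_ : Graph → Graph → Set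
G ≅ H = Σ (Fin (order G) ↔ Fin (order H)) λ σ →
  ∀ u v → mult G u v ≡ mult H (Inverse.to σ u) (Inverse.to σ v)

-- Tiles and pots over an alphabet of k bond-edge types (Fin k).
-- A half-edge label is (a , h) with h = false meaning the cohesive end a
-- and h = true meaning its complement â.  A tile is a finite multiset of
-- half-edge labels, given by its multiplicity function.

Tile : ℕ → Set
Tile k = Fin k → Bool → ℕ

SameTile : ∀ {k} → Tile k → Tile k → Set
SameTile t t′ = ∀ a h → t a h ≡ t′ a h

record Pot (k : ℕ) : Set where
  field
    ntiles   : ℕ
    tile     : Fin ntiles → Tile k
    distinct : ∀ i j → i ≢ j → ¬ SameTile (tile i) (tile j)

open Pot public

-- A realization of G by P: each vertex gets a tile type, each edge gets a
-- bond-edge type and an orientation (hatFirst e tells whether the first end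
-- of e carries the hatted half-edge; the second end carries the other one).
-- Condition: at every vertex, the multiset of half-edge labels on the
-- incident edge-ends equals the multiset of the assigned tile (this is the
-- existence of a label-preserving bijection, no half-edge unmatched).
record Realization {k : ℕ} (P : Pot k) (G : Graph) : Set where
  field
    tileOf   : Fin (order G) → Fin (ntiles P)
    bond     : Fin (size G) → Fin k
    hatFirst : Fin (size G) → Bool
    match    : ∀ (v : Fin (order G)) (a : Fin k) (h : Bool) →
      (Σ[< size G ] λ e →
          ind (⌊ proj₁ (ends G e) ≟ v ⌋ ∧ ⌊ bond e ≟ a ⌋ ∧ ⌊ hatFirst e BoolP.≟ h ⌋)
        + ind (⌊ proj₂ (ends G e) ≟ v ⌋ ∧ ⌊ bond e ≟ a ⌋ ∧ ⌊ not (hatFirst e) BoolP.≟ h ⌋))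
      ≡ tile P (tileOf v) a h

Realizes : ∀ {k} → Pot k → Graph → Set
Realizes P G = Realization P G

-- Scenario 3 admissibility: C_min(P) = {G} up to isomorphism.
-- (Graphs are taken to have at least one vertex.)
Admissible3 : ∀ {k} → Pot k → Graph → Set
Admissible3 P G =
  Realizes P G ×
  (∀ H → 1 ≤ order H → Realizes P H → order G < order H ⊎ H ≅ G)

IsB3 : Graph → ℕ → Set
IsB3 G m =
  Σ (Pot m) (λ P → Admissible3 P G) ×
  (∀ k (P : Pot k) → Admissible3 P G → m ≤ k)

-- Wheel graph W_n : hub = vertex zero, outer cycle on vertices suc i
-- (i : Fin (n-1)), edges: n-1 spokes then n-1 rim edges i — i+1 mod (n-1).

cnext : ∀ {m} → Fin m → Fin m
cnext {suc m} i = fromℕ< (m%n<n (suc (toℕ i)) (suc m))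

wheelEnds : ∀ m → Fin (m + m) → Fin (suc m) × Fin (suc m)
wheelEnds m e with splitAt m e
... | inj₁ i = zero , suc i
... | inj₂ i = suc i , suc (cnext i)

wheel : ℕ → Graph
wheel zero = record { order = 0 ; size = 0 ; ends = λ () }
wheel (suc m) = record { order = suc m ; size = m + m ; ends = wheelEnds m }

{-# OPTIONS --safe #-}

-- Lower bound: exchanging the ends of two equally bonded edges of the wheel yields another
-- graph realized by the same pot, hence again a wheel.  Two rim edges with the same bond and
-- the same orientation around the rim would cut the rim into two cycles, so a bond labels at
-- most two rim edges; a bond labelling two spokes labels no rim edge, since the exchange would
-- produce a double spoke.  If there are fewer bonds than spokes, some bond labels two spokes,
-- and the m rim edges need at least m/2 further bonds.
--
-- Upper bound: one bond for all spokes, and rim tiles arranged in levels 0, …, K with K = ⌊n/2⌋,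
-- where bond b leads from level b to level b + 1.  Level 0 starts two upward paths, one through
-- all levels and one through the levels up to c = n − 2 − K, and they meet again in the tile of
-- level K.  In any realized graph a level-K vertex starts two downward walks, which cannot
-- merge above level 0; with a hub they give n distinct vertices.  If the order is at most n
-- these are all vertices, the walks end in the only vertex of level 0, and the graph is W_n.

module Submission where

open import Defs
open import Data.Nat using (ℕ; _<_; _+_; _/_)
open import Data.Nat using (zero; suc; _*_; _∸_; _≤_; z≤n; s≤s; _%_)
import Data.Nat.Properties as ℕ
open import Data.Nat.DivMod using (m<n⇒m%n≡m; n%n≡0; m%n<n; m≡m%n+[m/n]*n)
open import Data.Nat.Solver using (module +-*-Solver)
open import Data.Fin using (Fin; zero; suc; toℕ; fromℕ; fromℕ<; _↑ˡ_; _↑ʳ_; splitAt; punchOut; combine)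
open import Data.Fin.Properties using (_≟_; any?; injective⇒≤; punchOut-injective; combine-injective; pigeonhole; toℕ<n; toℕ-injective; toℕ-fromℕ; toℕ-fromℕ<; splitAt-↑ˡ; splitAt-↑ʳ; splitAt⁻¹-↑ˡ; splitAt⁻¹-↑ʳ; ↑ˡ-injective; ↑ʳ-injective; suc-injective)
open import Data.Fin.Permutation using (Permutation; _⟨$⟩ʳ_; transpose)
import Data.Fin.Permutation.Components as PC
open import Data.Bool using (Bool; true; false; not; _∧_; _∨_)
import Data.Bool.Properties as Bool
open import Data.Sum using (_⊎_; inj₁; inj₂; [_,_]′)
open import Data.Product using (∃; ∃₂; _×_; _,_; proj₁; proj₂)
open import Data.Empty using (⊥)
open import Function.Base using (_∘_)
open import Function.Bundles using (_↔_; Inverse; mk↔ₛ′)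
open import Function.Definitions using (Injective)
open import Relation.Nullary using (¬_; Dec; yes; no; contradiction)
open import Relation.Nullary.Decidable using (⌊_⌋)
open import Relation.Binary using (tri<; tri≈; tri>)
open import Relation.Binary.PropositionalEquality
import Algebra.Properties.CommutativeMonoid.Sum ℕ.+-0-commutativeMonoid as Sum
open +-*-Solver using (solve; _:+_; _:*_; _:=_; con)

-- Finite sums

Σ≡sum : ∀ {n} (f : Fin n → ℕ) → Σ[< n ] f ≡ Sum.sum f
Σ≡sum {zero}  f = refl
Σ≡sum {suc n} f = cong (f zero +_) (Σ≡sum (f ∘ suc))

Σ-cong : ∀ {n} {f g : Fin n → ℕ} → (∀ i → f i ≡ g i) → Σ[< n ] f ≡ Σ[< n ] g
Σ-cong {zero}  f≗g = refl
Σ-cong {suc n} f≗g = cong₂ _+_ (f≗g zero) (Σ-cong (f≗g ∘ suc))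

Σ-zero : ∀ {n} {f : Fin n → ℕ} → (∀ i → f i ≡ 0) → Σ[< n ] f ≡ 0
Σ-zero {zero}  f≗0 = refl
Σ-zero {suc n} f≗0 = cong₂ _+_ (f≗0 zero) (Σ-zero (f≗0 ∘ suc))

Σ-const-1 : ∀ n → Σ[< n ] (λ _ → 1) ≡ n
Σ-const-1 zero    = refl
Σ-const-1 (suc n) = cong suc (Σ-const-1 n)

Σ-distrib-+ : ∀ {n} (f g : Fin n → ℕ) →
              Σ[< n ] (λ i → f i + g i) ≡ Σ[< n ] f + Σ[< n ] g
Σ-distrib-+ f g = trans (Σ≡sum (λ i → f i + g i))
  (trans (Sum.∑-distrib-+ f g) (sym (cong₂ _+_ (Σ≡sum f) (Σ≡sum g))))

Σ-comm : ∀ {m n} (f : Fin m → Fin n → ℕ) →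
         Σ[< m ] (λ i → Σ[< n ] (f i)) ≡ Σ[< n ] (λ j → Σ[< m ] (λ i → f i j))
Σ-comm {zero} {n} f = sym (Σ-zero {n} (λ _ → refl))
Σ-comm {suc m} f = trans (cong (Σ[< _ ] (f zero) +_) (Σ-comm (f ∘ suc)))
  (sym (Σ-distrib-+ (f zero) _))

Σ-permute : ∀ {m n} (f : Fin n → ℕ) (π : Permutation m n) →
            Σ[< m ] (λ i → f (π ⟨$⟩ʳ i)) ≡ Σ[< n ] f
Σ-permute f π = trans (Σ≡sum (λ i → f (π ⟨$⟩ʳ i)))
  (sym (trans (Σ≡sum f) (Sum.sum-permute f π)))

Σ-split : ∀ m {n} (f : Fin (m + n) → ℕ) →
          Σ[< m + n ] f ≡ Σ[< m ] (λ i → f (i ↑ˡ n)) + Σ[< n ] (λ i → f (m ↑ʳ i))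
Σ-split zero    f = refl
Σ-split (suc m) f =
  trans (cong (f zero +_) (Σ-split m (f ∘ suc))) (sym (ℕ.+-assoc (f zero) _ _))

Σ-single : ∀ {n} {f : Fin n → ℕ} i → (∀ j → j ≢ i → f j ≡ 0) → Σ[< n ] f ≡ f i
Σ-single {f = f} zero f≡0 =
  trans (cong (f zero +_) (Σ-zero (λ j → f≡0 (suc j) (λ ())))) (ℕ.+-identityʳ _)
Σ-single (suc i) f≡0 = cong₂ _+_ (f≡0 zero (λ ()))
  (Σ-single i (λ j j≢i → f≡0 (suc j) (λ { refl → j≢i refl })))

count≥1 : ∀ {n} {p : Fin n → Bool} i → p i ≡ true → 1 ≤ Σ[< n ] (ind ∘ p)
count≥1 {p = p} zero    pi rewrite pi = s≤s z≤n
count≥1 {p = p} (suc i) pi =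
  ℕ.≤-trans (count≥1 {p = p ∘ suc} i pi) (ℕ.m≤n+m _ (ind (p zero)))

count≥2 : ∀ {n} {p : Fin n → Bool} {i j} → i ≢ j → p i ≡ true → p j ≡ true →
          2 ≤ Σ[< n ] (ind ∘ p)
count≥2 {i = zero}  {zero}  i≢j pi pj = contradiction refl i≢j
count≥2 {p = p} {i = zero}  {suc j} i≢j pi pj rewrite pi =
  s≤s (count≥1 {p = p ∘ suc} j pj)
count≥2 {p = p} {i = suc i} {zero}  i≢j pi pj rewrite pj =
  s≤s (count≥1 {p = p ∘ suc} i pi)
count≥2 {p = p} {i = suc i} {suc j} i≢j pi pj = ℕ.≤-trans
  (count≥2 {p = p ∘ suc} (i≢j ∘ cong suc) pi pj) (ℕ.m≤n+m _ (ind (p zero)))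

1≤count⇒∃ : ∀ {n} {p : Fin n → Bool} → 1 ≤ Σ[< n ] (ind ∘ p) → ∃ λ i → p i ≡ true
1≤count⇒∃ {suc n} {p} 1≤Σ with p zero in eq
... | true  = zero , eq
... | false with 1≤count⇒∃ {p = p ∘ suc} 1≤Σ
...   | i , pi = suc i , pi

2≤count⇒∃₂ : ∀ {n} {p : Fin n → Bool} → 2 ≤ Σ[< n ] (ind ∘ p) →
             ∃₂ λ i j → i ≢ j × p i ≡ true × p j ≡ true
2≤count⇒∃₂ {suc n} {p} 2≤Σ with p zero in eq
2≤count⇒∃₂ {suc n} {p} (s≤s 1≤Σ) | true with 1≤count⇒∃ {p = p ∘ suc} 1≤Σ
... | i , pi = zero , suc i , (λ ()) , eq , pi
2≤count⇒∃₂ {suc n} {p} 2≤Σ | false with 2≤count⇒∃₂ {p = p ∘ suc} 2≤Σ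
... | i , j , i≢j , pi , pj = suc i , suc j , (λ { refl → i≢j refl }) , pi , pj

⌊⌋-true : ∀ {A : Set} (a? : Dec A) → A → ⌊ a? ⌋ ≡ true
⌊⌋-true (yes _) _ = refl
⌊⌋-true (no ¬a) a = contradiction a ¬a

⌊⌋-false : ∀ {A : Set} (a? : Dec A) → ¬ A → ⌊ a? ⌋ ≡ false
⌊⌋-false (yes a) ¬a = contradiction a ¬a
⌊⌋-false (no _)  _  = refl

⌊⌋∧⌊⌋⁻ : ∀ {A B : Set} (a? : Dec A) (b? : Dec B) → ⌊ a? ⌋ ∧ ⌊ b? ⌋ ≡ true → A × B
⌊⌋∧⌊⌋⁻ (yes a) (yes b) _ = a , b

⌊⌋∧⌊⌋⁺ : ∀ {A B : Set} (a? : Dec A) (b? : Dec B) → A → B → ⌊ a? ⌋ ∧ ⌊ b? ⌋ ≡ true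
⌊⌋∧⌊⌋⁺ a? b? a b = cong₂ _∧_ (⌊⌋-true a? a) (⌊⌋-true b? b)

∨-true⁻ : ∀ x {y} → x ∨ y ≡ true → x ≡ true ⊎ y ≡ true
∨-true⁻ true  _ = inj₁ refl
∨-true⁻ false q = inj₂ q

-- Injections between finite sets of the same size

injective⇒surjective : ∀ {m n} {f : Fin m → Fin n} → n ≤ m → Injective _≡_ _≡_ f →
                       ∀ y → ∃ λ x → f x ≡ y
injective⇒surjective {m} {suc n} {f} n≤m inj y with any? (λ x → f x ≟ y)
... | yes hit  = hit
... | no  miss = contradiction
  (ℕ.≤-trans n≤m (injective⇒≤ {f = λ x → punchOut (y≢f x)}
    (λ {x} {x′} eq → inj (punchOut-injective (y≢f x) (y≢f x′) eq))))
  ℕ.1+n≰n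
  where
  y≢f : ∀ x → y ≢ f x
  y≢f x y≡fx = miss (x , sym y≡fx)

injective⇒↔ : ∀ {m n} (f : Fin m → Fin n) → n ≤ m → Injective _≡_ _≡_ f → Fin m ↔ Fin n
injective⇒↔ f n≤m inj = mk↔ₛ′ f (proj₁ ∘ onto) (proj₂ ∘ onto) (inj ∘ proj₂ ∘ onto ∘ f)
  where onto = injective⇒surjective n≤m inj

-- Edge multiplicities

Joins : ∀ {n} → Fin n × Fin n → Fin n → Fin n → Set
Joins p u v = (proj₁ p ≡ u × proj₂ p ≡ v) ⊎ (proj₁ p ≡ v × proj₂ p ≡ u)

joins : ∀ {n} → Fin n × Fin n → Fin n → Fin n → Bool
joins p u v =
  (⌊ proj₁ p ≟ u ⌋ ∧ ⌊ proj₂ p ≟ v ⌋) ∨ (⌊ proj₁ p ≟ v ⌋ ∧ ⌊ proj₂ p ≟ u ⌋)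

joins⁺ : ∀ {n} (p : Fin n × Fin n) {u v} → Joins p u v → joins p u v ≡ true
joins⁺ p {u} {v} (inj₁ (x , y)) =
  cong (_∨ (⌊ proj₁ p ≟ v ⌋ ∧ ⌊ proj₂ p ≟ u ⌋)) (⌊⌋∧⌊⌋⁺ (proj₁ p ≟ u) (proj₂ p ≟ v) x y)
joins⁺ p {u} {v} (inj₂ (x , y)) = trans
  (cong ((⌊ proj₁ p ≟ u ⌋ ∧ ⌊ proj₂ p ≟ v ⌋) ∨_)
    (⌊⌋∧⌊⌋⁺ (proj₁ p ≟ v) (proj₂ p ≟ u) x y)) (Bool.∨-zeroʳ _)

joins⁻ : ∀ {n} (p : Fin n × Fin n) {u v} → joins p u v ≡ true → Joins p u v
joins⁻ p {u} {v} t with ∨-true⁻ (⌊ proj₁ p ≟ u ⌋ ∧ ⌊ proj₂ p ≟ v ⌋) t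
... | inj₁ q = inj₁ (⌊⌋∧⌊⌋⁻ (proj₁ p ≟ u) (proj₂ p ≟ v) q)
... | inj₂ q = inj₂ (⌊⌋∧⌊⌋⁻ (proj₁ p ≟ v) (proj₂ p ≟ u) q)

module _ (G : Graph) {u v : Fin (order G)} where

  mult≥1 : ∀ e → Joins (ends G e) u v → 1 ≤ mult G u v
  mult≥1 e j = count≥1 {p = λ e → joins (ends G e) u v} e (joins⁺ (ends G e) j)

  mult≥2 : ∀ {e f} → e ≢ f → Joins (ends G e) u v → Joins (ends G f) u v → 2 ≤ mult G u v
  mult≥2 {e} {f} e≢f j j′ = count≥2 {p = λ e → joins (ends G e) u v} e≢f
    (joins⁺ (ends G e) j) (joins⁺ (ends G f) j′)

  1≤mult⇒∃ : 1 ≤ mult G u v → ∃ λ e → Joins (ends G e) u v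
  1≤mult⇒∃ 1≤m with 1≤count⇒∃ {p = λ e → joins (ends G e) u v} 1≤m
  ... | e , t = e , joins⁻ (ends G e) t

  2≤mult⇒∃₂ : 2 ≤ mult G u v →
              ∃₂ λ e f → e ≢ f × Joins (ends G e) u v × Joins (ends G f) u v
  2≤mult⇒∃₂ 2≤m with 2≤count⇒∃₂ {p = λ e → joins (ends G e) u v} 2≤m
  ... | e , f , e≢f , t , t′ = e , f , e≢f , joins⁻ (ends G e) t , joins⁻ (ends G f) t′

-- Half-edges of a realization

-- The end carrying the label h of an edge whose first end carries the label hf.
labelled : ∀ {A : Set} → (hf h : Bool) → A × A → A
labelled false false = proj₁
labelled false true  = proj₂
labelled true  false = proj₂
labelled true  true  = proj₁

labelled-same : ∀ {A : Set} h {p : A × A} → labelled h h p ≡ proj₁ p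
labelled-same false = refl
labelled-same true  = refl

labelled-opp : ∀ {A : Set} h {p : A × A} → labelled h (not h) p ≡ proj₂ p
labelled-opp false = refl
labelled-opp true  = refl

ind-∧true : ∀ x b → ind (x ∧ b ∧ true) ≡ ind (x ∧ b)
ind-∧true x b = cong (λ y → ind (x ∧ y)) (Bool.∧-identityʳ b)

ind-∧false : ∀ x b → ind (x ∧ b ∧ false) ≡ 0
ind-∧false x b = cong ind (trans (cong (x ∧_) (Bool.∧-zeroʳ b)) (Bool.∧-zeroʳ x))

half-edge-count : ∀ {n} hf h (p : Fin n × Fin n) v b →
    ind (⌊ proj₁ p ≟ v ⌋ ∧ b ∧ ⌊ hf Bool.≟ h ⌋)
  + ind (⌊ proj₂ p ≟ v ⌋ ∧ b ∧ ⌊ not hf Bool.≟ h ⌋)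
  ≡ ind (⌊ labelled hf h p ≟ v ⌋ ∧ b)
half-edge-count false false p v b = trans
  (cong₂ _+_ (ind-∧true ⌊ proj₁ p ≟ v ⌋ b) (ind-∧false ⌊ proj₂ p ≟ v ⌋ b)) (ℕ.+-identityʳ _)
half-edge-count false true  p v b =
  cong₂ _+_ (ind-∧false ⌊ proj₁ p ≟ v ⌋ b) (ind-∧true ⌊ proj₂ p ≟ v ⌋ b)
half-edge-count true  false p v b =
  cong₂ _+_ (ind-∧false ⌊ proj₁ p ≟ v ⌋ b) (ind-∧true ⌊ proj₂ p ≟ v ⌋ b)
half-edge-count true  true  p v b = trans
  (cong₂ _+_ (ind-∧true ⌊ proj₁ p ≟ v ⌋ b) (ind-∧false ⌊ proj₂ p ≟ v ⌋ b)) (ℕ.+-identityʳ _)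

realization : ∀ {k} (P : Pot k) (G : Graph)
  (tileOf : Fin (order G) → Fin (ntiles P)) (bond : Fin (size G) → Fin k)
  (hatFirst : Fin (size G) → Bool) →
  (∀ v a h → Σ[< size G ] (λ e →
      ind (⌊ labelled (hatFirst e) h (ends G e) ≟ v ⌋ ∧ ⌊ bond e ≟ a ⌋))
    ≡ tile P (tileOf v) a h) →
  Realization P G
realization P G tileOf bond hatFirst counts = record
  { tileOf   = tileOf
  ; bond     = bond
  ; hatFirst = hatFirst
  ; match    = λ v a h → trans
      (Σ-cong (λ e → half-edge-count (hatFirst e) h (ends G e) v ⌊ bond e ≟ a ⌋))
      (counts v a h)
  }

module HalfEdges {k} {P : Pot k} {G : Graph} (R : Realization P G) where

  open Realization R public

  end : Bool → Fin (size G) → Fin (order G)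
  end h e = labelled (hatFirst e) h (ends G e)

  degree : ∀ v a h →
    Σ[< size G ] (λ e → ind (⌊ end h e ≟ v ⌋ ∧ ⌊ bond e ≟ a ⌋)) ≡ tile P (tileOf v) a h
  degree v a h = trans
    (Σ-cong (λ e → sym (half-edge-count (hatFirst e) h (ends G e) v ⌊ bond e ≟ a ⌋)))
    (match v a h)

  half-edge? : Fin (order G) → Fin k → Bool → Fin (size G) → Bool
  half-edge? v a h e = ⌊ end h e ≟ v ⌋ ∧ ⌊ bond e ≟ a ⌋

  half-edge : ∀ v a h → 1 ≤ tile P (tileOf v) a h → ∃ λ e → end h e ≡ v × bond e ≡ a
  half-edge v a h 1≤t
    with 1≤count⇒∃ {p = half-edge? v a h} (subst (1 ≤_) (sym (degree v a h)) 1≤t)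
  ... | e , t = e , ⌊⌋∧⌊⌋⁻ (end h e ≟ v) (bond e ≟ a) t

  two-half-edges : ∀ v a h → 2 ≤ tile P (tileOf v) a h →
    ∃₂ λ e f → e ≢ f × (end h e ≡ v × bond e ≡ a) × (end h f ≡ v × bond f ≡ a)
  two-half-edges v a h 2≤t
    with 2≤count⇒∃₂ {p = half-edge? v a h} (subst (2 ≤_) (sym (degree v a h)) 2≤t)
  ... | e , f , e≢f , t , t′ = e , f , e≢f ,
    ⌊⌋∧⌊⌋⁻ (end h e ≟ v) (bond e ≟ a) t , ⌊⌋∧⌊⌋⁻ (end h f ≟ v) (bond f ≟ a) t′

  half-edge-unique : ∀ {v a} h → tile P (tileOf v) a h ≤ 1 → ∀ {e f} →
    end h e ≡ v → bond e ≡ a → end h f ≡ v → bond f ≡ a → e ≡ f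
  half-edge-unique {v} {a} h t≤1 {e} {f} p q p′ q′ with e ≟ f
  ... | yes e≡f = e≡f
  ... | no  e≢f = contradiction
    (ℕ.≤-trans (subst (2 ≤_) (degree v a h) (count≥2 {p = half-edge? v a h} e≢f
      (⌊⌋∧⌊⌋⁺ (end h e ≟ v) (bond e ≟ a) p q) (⌊⌋∧⌊⌋⁺ (end h f ≟ v) (bond f ≟ a) p′ q′)))
      t≤1)
    ℕ.1+n≰n

  label-in-tile : ∀ h e → 1 ≤ tile P (tileOf (end h e)) (bond e) h
  label-in-tile h e = subst (1 ≤_) (degree (end h e) (bond e) h)
    (count≥1 {p = half-edge? (end h e) (bond e) h} e
      (⌊⌋∧⌊⌋⁺ (end h e ≟ end h e) (bond e ≟ bond e) refl refl))

  mult-end : ∀ u v →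
    mult G u v ≡ Σ[< size G ] (λ e → ind (joins (end false e , end true e) u v))
  mult-end u v = Σ-cong (λ e → cong ind (reorient (hatFirst e) (ends G e)))
    where
    reorient : ∀ hf p → joins p u v ≡ joins (labelled hf false p , labelled hf true p) u v
    reorient false p = refl
    reorient true  p = trans (Bool.∨-comm (⌊ proj₁ p ≟ u ⌋ ∧ _) _)
      (cong₂ _∨_ (Bool.∧-comm ⌊ proj₁ p ≟ v ⌋ _) (Bool.∧-comm ⌊ proj₁ p ≟ u ⌋ _))

  size≡ : size G ≡ Σ[< order G ] (λ v → Σ[< k ] (λ a → tile P (tileOf v) a false))
  size≡ = begin
    size G
      ≡⟨ Σ-const-1 (size G) ⟨
    Σ[< size G ] (λ _ → 1)
      ≡⟨ Σ-cong (λ e → sym (one e)) ⟩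
    Σ[< size G ] (λ e → Σ[< order G ] (λ v → Σ[< k ] (λ a → ind (half-edge? v a false e))))
      ≡⟨ Σ-comm (λ e v → Σ[< k ] (λ a → ind (half-edge? v a false e))) ⟩
    Σ[< order G ] (λ v → Σ[< size G ] (λ e → Σ[< k ] (λ a → ind (half-edge? v a false e))))
      ≡⟨ Σ-cong (λ v → Σ-comm (λ e a → ind (half-edge? v a false e))) ⟩
    Σ[< order G ] (λ v → Σ[< k ] (λ a → Σ[< size G ] (λ e → ind (half-edge? v a false e))))
      ≡⟨ Σ-cong (λ v → Σ-cong (λ a → degree v a false)) ⟩
    Σ[< order G ] (λ v → Σ[< k ] (λ a → tile P (tileOf v) a false))
      ∎
    where
    open ≡-Reasoning
    one : ∀ e → Σ[< order G ] (λ v → Σ[< k ] (λ a → ind (half-edge? v a false e))) ≡ 1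
    one e = trans
      (Σ-single (end false e) (λ v v≢ → Σ-zero (λ a → cong (λ b → ind (b ∧ ⌊ bond e ≟ a ⌋))
        (⌊⌋-false (end false e ≟ v) (v≢ ∘ sym)))))
      (trans
        (Σ-single (bond e) (λ a a≢ → cong ind (trans
          (cong (⌊ end false e ≟ end false e ⌋ ∧_) (⌊⌋-false (bond e ≟ a) (a≢ ∘ sym)))
          (Bool.∧-zeroʳ _))))
        (cong ind (⌊⌋∧⌊⌋⁺ (end false e ≟ end false e) (bond e ≟ bond e) refl refl)))

≟-injective : ∀ {m n} {f : Fin m → Fin n} → Injective _≡_ _≡_ f →
              ∀ x y → ⌊ f x ≟ f y ⌋ ≡ ⌊ x ≟ y ⌋
≟-injective {f = f} inj x y with x ≟ y
... | yes x≡y = ⌊⌋-true (f x ≟ f y) (cong f x≡y)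
... | no  x≢y = ⌊⌋-false (f x ≟ f y) (x≢y ∘ inj)

-- Equality of the tiles at v and φ v forces the two sizes to agree, so the edge injection
-- is a bijection.
embedding⇒≅ : ∀ {k} {P : Pot k} {G H : Graph} (R : Realization P G) (S : Realization P H) →
  let module R = HalfEdges R; module S = HalfEdges S in
  order H ≤ order G →
  (φ : Fin (order G) → Fin (order H)) → Injective _≡_ _≡_ φ →
  (ψ : Fin (size G) → Fin (size H)) → Injective _≡_ _≡_ ψ →
  (∀ v → S.tileOf (φ v) ≡ R.tileOf v) →
  (∀ h e → S.end h (ψ e) ≡ φ (R.end h e)) →
  H ≅ G
embedding⇒≅ {k} {P} {G} {H} R S H≤G φ φ-inj ψ ψ-inj same-tile same-end =
  mk↔ₛ′ φ⁻¹ φ (λ v → φ-inj (φφ⁻¹ (φ v))) φφ⁻¹ , mult≡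
  where
  module R = HalfEdges R
  module S = HalfEdges S
  open ≡-Reasoning
  vertices = injective⇒↔ φ H≤G φ-inj
  φ⁻¹ = Inverse.from vertices
  φφ⁻¹ : ∀ v → φ (φ⁻¹ v) ≡ v
  φφ⁻¹ v = Inverse.strictlyInverseˡ vertices v
  sizes : size H ≡ size G
  sizes = begin
    size H
      ≡⟨ S.size≡ ⟩
    Σ[< order H ] (λ v → Σ[< k ] (λ a → tile P (S.tileOf v) a false))
      ≡⟨ Σ-permute (λ v → Σ[< k ] (λ a → tile P (S.tileOf v) a false)) vertices ⟨
    Σ[< order G ] (λ v → Σ[< k ] (λ a → tile P (S.tileOf (φ v)) a false))
      ≡⟨ Σ-cong (λ v → Σ-cong (λ a → cong (λ t → tile P t a false) (same-tile v))) ⟩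
    Σ[< order G ] (λ v → Σ[< k ] (λ a → tile P (R.tileOf v) a false))
      ≡⟨ R.size≡ ⟨
    size G
      ∎
  edges = injective⇒↔ ψ (ℕ.≤-reflexive sizes) ψ-inj
  joins-φ : ∀ x y u v → joins (φ x , φ y) (φ u) (φ v) ≡ joins (x , y) u v
  joins-φ x y u v = cong₂ _∨_
    (cong₂ _∧_ (≟-injective φ-inj x u) (≟-injective φ-inj y v))
    (cong₂ _∧_ (≟-injective φ-inj x v) (≟-injective φ-inj y u))
  multφ : ∀ u v → mult H (φ u) (φ v) ≡ mult G u v
  multφ u v = begin
    mult H (φ u) (φ v)
      ≡⟨ S.mult-end (φ u) (φ v) ⟩
    Σ[< size H ] (λ e → ind (joins (S.end false e , S.end true e) (φ u) (φ v)))
      ≡⟨ Σ-permute (λ e → ind (joins (S.end false e , S.end true e) (φ u) (φ v))) edges ⟨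
    Σ[< size G ] (λ e → ind (joins (S.end false (ψ e) , S.end true (ψ e)) (φ u) (φ v)))
      ≡⟨ Σ-cong (λ e → cong ind (trans
           (cong₂ (λ x y → joins (x , y) (φ u) (φ v)) (same-end false e) (same-end true e))
           (joins-φ (R.end false e) (R.end true e) u v))) ⟩
    Σ[< size G ] (λ e → ind (joins (R.end false e , R.end true e) u v))
      ≡⟨ R.mult-end u v ⟨
    mult G u v
      ∎
  mult≡ : ∀ u v → mult H u v ≡ mult G (φ⁻¹ u) (φ⁻¹ v)
  mult≡ u v = trans (sym (cong₂ (mult H) (φφ⁻¹ u) (φφ⁻¹ v))) (multφ (φ⁻¹ u) (φ⁻¹ v))

-- The rim cycle

cnext-cases : ∀ {m} (i : Fin m) →
  toℕ (cnext i) ≡ suc (toℕ i) ⊎ (toℕ (cnext i) ≡ 0 × suc (toℕ i) ≡ m)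
cnext-cases {suc m} i with ℕ.m≤n⇒m<n∨m≡n (toℕ<n i)
... | inj₁ i<m = inj₁ (trans (toℕ-fromℕ< _) (m<n⇒m%n≡m i<m))
... | inj₂ i≡m = inj₂
  (trans (toℕ-fromℕ< _) (trans (cong (_% suc m) i≡m) (n%n≡0 (suc m))) , i≡m)

cnext-injective : ∀ {m} {i j : Fin m} → cnext i ≡ cnext j → i ≡ j
cnext-injective {i = i} {j} eq with cnext-cases i | cnext-cases j
... | inj₁ p       | inj₁ q       =
  toℕ-injective (ℕ.suc-injective (trans (sym p) (trans (cong toℕ eq) q)))
... | inj₂ (_ , p) | inj₂ (_ , q) = toℕ-injective (ℕ.suc-injective (trans p (sym q)))
... | inj₁ p       | inj₂ (q , _) =
  contradiction (trans (sym p) (trans (cong toℕ eq) q)) ℕ.1+n≢0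
... | inj₂ (p , _) | inj₁ q       =
  contradiction (trans (sym q) (trans (cong toℕ (sym eq)) p)) ℕ.1+n≢0

cnext^ : ∀ {m} → ℕ → Fin m → Fin m
cnext^ zero    i = i
cnext^ (suc r) i = cnext (cnext^ r i)

toℕ-cnext^ : ∀ {m} r (i : Fin m) → r ≤ m →
  toℕ i + r ≡ toℕ (cnext^ r i) ⊎ toℕ i + r ≡ m + toℕ (cnext^ r i)
toℕ-cnext^ zero i _ = inj₁ (ℕ.+-identityʳ _)
toℕ-cnext^ {m} (suc r) i r<m
  with toℕ-cnext^ r i (ℕ.<⇒≤ r<m) | cnext-cases (cnext^ r i)
... | inj₁ p | inj₁ q = inj₁ (trans (ℕ.+-suc _ r) (trans (cong suc p) (sym q)))
... | inj₁ p | inj₂ (z , q) = inj₂ (trans (ℕ.+-suc _ r) (trans (cong suc p)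
  (trans q (trans (sym (ℕ.+-identityʳ m)) (cong (m +_) (sym z))))))
... | inj₂ p | inj₁ q = inj₂ (trans (ℕ.+-suc _ r) (trans (cong suc p)
  (trans (sym (ℕ.+-suc m _)) (cong (m +_) (sym q)))))
... | inj₂ p | inj₂ (z , q) = contradiction
  (subst (_< m + m) (trans (ℕ.+-suc _ r) (trans (cong suc p)
    (trans (sym (ℕ.+-suc m _)) (cong (m +_) q)))) (ℕ.+-mono-<-≤ (toℕ<n i) r<m))
  (ℕ.<-irrefl refl)

cnext^-≢ : ∀ {m} r (i : Fin m) → 0 < r → r < m → cnext^ r i ≢ i
cnext^-≢ {m} r i 0<r r<m eq with toℕ-cnext^ r i (ℕ.<⇒≤ r<m)
... | inj₁ p rewrite eq = ℕ.<⇒≢ 0<r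
  (sym (ℕ.+-cancelˡ-≡ (toℕ i) r 0 (trans p (sym (ℕ.+-identityʳ _)))))
... | inj₂ p rewrite eq = ℕ.<⇒≢ r<m (ℕ.+-cancelˡ-≡ (toℕ i) r m (trans p (ℕ.+-comm m _)))

cnext-closed : ∀ {m} (Q : Fin m → Set) → (∀ i → Q i → Q (cnext i)) →
               ∀ {i} → Q i → ∀ j → Q j
cnext-closed {suc m} Q step {i} Qi j = climb (toℕ j) j (sym (ℕ.+-identityʳ _)) Q0
  where
  climb : ∀ d {i} j → toℕ j ≡ d + toℕ i → Q i → Q j
  climb zero    j eq q = subst Q (toℕ-injective (sym eq)) q
  climb (suc d) {i} j eq q with cnext-cases i
  ... | inj₁ p       = climb d j
    (trans eq (trans (sym (ℕ.+-suc d _)) (cong (d +_) (sym p)))) (step i q)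
  ... | inj₂ (_ , p) = contradiction
    (ℕ.<-≤-trans (toℕ<n j) (subst (_≤ toℕ j) p
      (subst (suc (toℕ i) ≤_) (sym eq) (s≤s (ℕ.m≤n+m _ d))))) (ℕ.<-irrefl refl)
  last : Fin (suc m)
  last = fromℕ m
  Q0 : Q zero
  Q0 with cnext-cases last
  ... | inj₂ (z , _) = subst Q (toℕ-injective z) (step last
    (climb (m ∸ toℕ i) last
      (trans (toℕ-fromℕ m) (sym (ℕ.m∸n+n≡m (ℕ.≤-pred (toℕ<n i))))) Qi))
  ... | inj₁ p = contradiction
    (trans p (cong suc (toℕ-fromℕ m)))
    (ℕ.<⇒≢ (toℕ<n (cnext last)))

-- The wheel

data WheelEdge (m : ℕ) : Fin (m + m) → Set where
  spoke : ∀ i → WheelEdge m (i ↑ˡ m)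
  rim   : ∀ i → WheelEdge m (m ↑ʳ i)

wheelEdge : ∀ m (e : Fin (m + m)) → WheelEdge m e
wheelEdge m e with splitAt m e in eq
... | inj₁ i = subst (WheelEdge m) (splitAt⁻¹-↑ˡ eq) (spoke i)
... | inj₂ i = subst (WheelEdge m) (splitAt⁻¹-↑ʳ eq) (rim i)

spoke-ends : ∀ {m} (i : Fin m) → wheelEnds m (i ↑ˡ m) ≡ (zero , suc i)
spoke-ends {m} i rewrite splitAt-↑ˡ m i m = refl

rim-ends : ∀ {m} (i : Fin m) → wheelEnds m (m ↑ʳ i) ≡ (suc i , suc (cnext i))
rim-ends {m} i rewrite splitAt-↑ʳ m m i = refl

spoke≢rim : ∀ {m} (i j : Fin m) → i ↑ˡ m ≢ m ↑ʳ j
spoke≢rim {m} i j eq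
  with () ← trans (sym (splitAt-↑ˡ m i m)) (trans (cong (splitAt m) eq) (splitAt-↑ʳ m m j))

module _ {m} (4≤m : 4 ≤ m) where

  private
    W = wheel (suc m)
    r<m : ∀ {r} → r < 4 → r < m
    r<m r<4 = ℕ.<-≤-trans r<4 4≤m
    next≢ : ∀ (i : Fin m) → cnext i ≢ i
    next≢ i = cnext^-≢ 1 i (s≤s z≤n) (r<m (s≤s (s≤s z≤n)))
    next²≢ : ∀ (i : Fin m) → cnext (cnext i) ≢ i
    next²≢ i = cnext^-≢ 2 i (s≤s z≤n) (r<m (s≤s (s≤s (s≤s z≤n))))
    next³≢ : ∀ (i : Fin m) → cnext (cnext (cnext i)) ≢ i
    next³≢ i = cnext^-≢ 3 i (s≤s z≤n) (r<m (s≤s (s≤s (s≤s (s≤s z≤n)))))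

  wheel-loopless : ∀ e u → ¬ Joins (ends W e) u u
  wheel-loopless e u j with wheelEdge m e
  wheel-loopless .(i ↑ˡ m) u j | spoke i rewrite spoke-ends i with j
  ... | inj₁ (refl , ())
  ... | inj₂ (refl , ())
  wheel-loopless .(m ↑ʳ i) u j | rim i rewrite rim-ends i with j
  ... | inj₁ (refl , q) = next≢ i (suc-injective q)
  ... | inj₂ (refl , q) = next≢ i (suc-injective q)

  wheel-simple : ∀ {e f u v} → Joins (ends W e) u v → Joins (ends W f) u v → e ≡ f
  wheel-simple {e} {f} j j′ with wheelEdge m e | wheelEdge m f
  wheel-simple j j′ | spoke i | spoke i′ rewrite spoke-ends i | spoke-ends i′ with j | j′
  ... | inj₁ (refl , refl) | inj₁ (_ , q) = cong (_↑ˡ m) (sym (suc-injective q))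
  ... | inj₁ (refl , refl) | inj₂ (() , _)
  ... | inj₂ (refl , refl) | inj₁ (() , _)
  ... | inj₂ (refl , refl) | inj₂ (_ , q) = cong (_↑ˡ m) (sym (suc-injective q))
  wheel-simple j j′ | spoke i | rim i′ rewrite spoke-ends i | rim-ends i′ with j | j′
  ... | inj₁ (refl , refl) | inj₁ (() , _)
  ... | inj₁ (refl , refl) | inj₂ (_ , ())
  ... | inj₂ (refl , refl) | inj₁ (_ , ())
  ... | inj₂ (refl , refl) | inj₂ (() , _)
  wheel-simple j j′ | rim i | spoke i′ rewrite rim-ends i | spoke-ends i′ with j | j′
  ... | inj₁ (refl , refl) | inj₁ (() , _)
  ... | inj₁ (refl , refl) | inj₂ (() , _)
  ... | inj₂ (refl , refl) | inj₁ (() , _)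
  ... | inj₂ (refl , refl) | inj₂ (() , _)
  wheel-simple j j′ | rim i | rim i′ rewrite rim-ends i | rim-ends i′ with j | j′
  ... | inj₁ (refl , refl) | inj₁ (p , _) = cong (m ↑ʳ_) (sym (suc-injective p))
  ... | inj₁ (refl , refl) | inj₂ (p , q) = contradiction
    (trans (cong cnext (suc-injective (sym p))) (suc-injective q)) (next²≢ i)
  ... | inj₂ (refl , refl) | inj₁ (p , q) = contradiction
    (trans (cong cnext (suc-injective (sym p))) (suc-injective q)) (next²≢ i)
  ... | inj₂ (refl , refl) | inj₂ (p , _) = cong (m ↑ʳ_) (sym (suc-injective p))

  wheel-rim-not-universal : ∀ i → ∃ λ v → v ≢ suc i × ∀ e → ¬ Joins (ends W e) (suc i) v
  wheel-rim-not-universal i =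
    suc (cnext (cnext i)) , next²≢ i ∘ suc-injective , not-joined
    where
    not-joined : ∀ e → ¬ Joins (ends W e) (suc i) (suc (cnext (cnext i)))
    not-joined e j with wheelEdge m e
    not-joined e j | spoke l rewrite spoke-ends l with j
    ... | inj₁ (() , _)
    ... | inj₂ (() , _)
    not-joined e j | rim l rewrite rim-ends l with j
    ... | inj₁ (refl , q) = next≢ i (sym (cnext-injective (suc-injective q)))
    ... | inj₂ (refl , q) = next³≢ i (suc-injective q)

  module Iso (H : Graph) (H≅W : H ≅ W) where

    open Inverse (proj₁ H≅W) using (to; from; strictlyInverseˡ; strictlyInverseʳ) public

    edge-in-wheel : ∀ {e u v} → Joins (ends H e) u v →
                    ∃ λ f → Joins (ends W f) (to u) (to v)
    edge-in-wheel {e} {u} {v} j =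
      1≤mult⇒∃ W (subst (1 ≤_) (proj₂ H≅W u v) (mult≥1 H e j))

    edge-from-wheel : ∀ {f u v} → Joins (ends W f) (to u) (to v) →
                      ∃ λ e → Joins (ends H e) u v
    edge-from-wheel {f} {u} {v} j =
      1≤mult⇒∃ H (subst (1 ≤_) (sym (proj₂ H≅W u v)) (mult≥1 W f j))

    loopless : ∀ e u → ¬ Joins (ends H e) u u
    loopless e u j with edge-in-wheel {e} j
    ... | f , j′ = wheel-loopless f _ j′

    simple : ∀ {e f u v} → Joins (ends H e) u v → Joins (ends H f) u v → e ≡ f
    simple {e} {f} {u} {v} j j′ with e ≟ f
    ... | yes e≡f = e≡f
    ... | no  e≢f
      with 2≤mult⇒∃₂ W (subst (2 ≤_) (proj₂ H≅W u v) (mult≥2 H e≢f j j′))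
    ...   | _ , _ , e′≢f′ , i , i′ = contradiction (wheel-simple i i′) e′≢f′

    hub-image : ∀ z → (∀ v → v ≢ z → ∃ λ e → Joins (ends H e) z v) → to z ≡ zero
    hub-image z universal with to z in eq
    ... | zero  = refl
    ... | suc i with wheel-rim-not-universal i
    ...   | v , v≢ , not-joined with universal (from v)
                (λ fv≡z → v≢ (trans (sym (strictlyInverseˡ v)) (trans (cong to fv≡z) eq)))
    ...     | e , j with edge-in-wheel {e} j
    ...       | f , j′ = contradiction
                (subst₂ (Joins (ends W f)) eq (strictlyInverseˡ v) j′) (not-joined f)

labelled-joins : ∀ {n} hf h (p : Fin n × Fin n) →
  Joins (labelled hf h p , labelled hf (not h) p) (proj₁ p) (proj₂ p)
labelled-joins false false p = inj₁ (refl , refl)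
labelled-joins false true  p = inj₂ (refl , refl)
labelled-joins true  false p = inj₂ (refl , refl)
labelled-joins true  true  p = inj₁ (refl , refl)

transpose-matchˡ : ∀ {n} (i j : Fin n) → PC.transpose i j i ≡ j
transpose-matchˡ i j with i ≟ i
... | yes _   = refl
... | no  i≢i = contradiction refl i≢i

transpose-matchʳ : ∀ {n} (i j : Fin n) → PC.transpose i j j ≡ i
transpose-matchʳ i j with j ≟ i
... | yes j≡i = j≡i
... | no  _ with j ≟ j
...   | yes _   = refl
...   | no  j≢j = contradiction refl j≢j

transpose-mismatch : ∀ {n} {i j l : Fin n} → l ≢ i → l ≢ j → PC.transpose i j l ≡ l
transpose-mismatch {i = i} {j} {l} l≢i l≢j with l ≟ i
... | yes l≡i = contradiction l≡i l≢i
... | no  _ with l ≟ j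
...   | yes l≡j = contradiction l≡j l≢j
...   | no  _   = refl

boolToFin : Bool → Fin 2
boolToFin false = zero
boolToFin true  = suc zero

boolToFin-injective : ∀ {b c} → boolToFin b ≡ boolToFin c → b ≡ c
boolToFin-injective {false} {false} _ = refl
boolToFin-injective {true}  {true}  _ = refl

two-per-colour : ∀ {m k} (f : Fin m → Fin k) (g : Fin m → Bool) a → (∀ i → a ≢ f i) →
  (∀ i j → f i ≡ f j → g i ≡ g j → i ≡ j) → 2 + m ≤ k * 2
two-per-colour {k = suc k} f g a a≢f inj = s≤s (s≤s (injective⇒≤
  {f = λ i → combine (punchOut (a≢f i)) (boolToFin (g i))}
  λ {i} {j} eq → let p , q = combine-injective _ _ _ _ eq in
    inj i j (punchOut-injective (a≢f i) (a≢f j) p) (boolToFin-injective q)))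

-- Lower bound

module Swap {k} {P : Pot k} {G : Graph} (R : Realization P G) where

  open HalfEdges R

  swapEnds : Bool → Fin (size G) → Fin (size G) → Graph
  swapEnds h e f = record
    { order = order G
    ; size  = size G
    ; ends  = λ x → end h x , end (not h) (PC.transpose e f x)
    }

  swapEnds-realization : ∀ h {e f} → bond e ≡ bond f → Realization P (swapEnds h e f)
  swapEnds-realization h {e} {f} same = realization P (swapEnds h e f) tileOf bond (λ _ → h)
    (counts h)
    where
    bond-τ : ∀ x → bond (PC.transpose e f x) ≡ bond x
    bond-τ x with x ≟ e
    ... | yes refl = sym same
    ... | no  _ with x ≟ f
    ...   | yes refl = same
    ...   | no  _    = refl
    moved : ∀ v a h →
      Σ[< size G ] (λ x → ind (⌊ end h (PC.transpose e f x) ≟ v ⌋ ∧ ⌊ bond x ≟ a ⌋))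
      ≡ tile P (tileOf v) a h
    moved v a h = trans
      (Σ-cong (λ x → cong (λ b → ind (⌊ end h (PC.transpose e f x) ≟ v ⌋ ∧ ⌊ b ≟ a ⌋))
        (sym (bond-τ x))))
      (trans (Σ-permute (λ x → ind (⌊ end h x ≟ v ⌋ ∧ ⌊ bond x ≟ a ⌋)) (transpose e f))
        (degree v a h))
    counts : ∀ h v a h′ → Σ[< size G ] (λ x →
        ind (⌊ labelled h h′ (end h x , end (not h) (PC.transpose e f x)) ≟ v ⌋ ∧ ⌊ bond x ≟ a ⌋))
      ≡ tile P (tileOf v) a h′
    counts false v a false = degree v a false
    counts false v a true  = moved v a true
    counts true  v a false = moved v a false
    counts true  v a true  = degree v a true

module LowerBound {m} (4≤m : 4 ≤ m) {k} (P : Pot k) (adm : Admissible3 P (wheel (suc m))) where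

  open HalfEdges (proj₁ adm)
  open Swap (proj₁ adm)

  swapEnds-≅ : ∀ h {e f} → bond e ≡ bond f → swapEnds h e f ≅ wheel (suc m)
  swapEnds-≅ h {e} {f} same
    with proj₂ adm (swapEnds h e f) (s≤s z≤n) (swapEnds-realization h same)
  ... | inj₁ n<n = contradiction n<n (ℕ.<-irrefl refl)
  ... | inj₂ iso = iso

  hub-or : ∀ h i → end h (i ↑ˡ m) ≡ zero × end (not h) (i ↑ˡ m) ≡ suc i
                 ⊎ end h (i ↑ˡ m) ≡ suc i × end (not h) (i ↑ˡ m) ≡ zero
  hub-or h i = subst (λ p → Joins (end h (i ↑ˡ m) , end (not h) (i ↑ˡ m)) (proj₁ p) (proj₂ p))
    (spoke-ends i) (labelled-joins (hatFirst (i ↑ˡ m)) h (wheelEnds m (i ↑ˡ m)))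

  rim-end : ∀ h i → ∃ λ y → end h (m ↑ʳ i) ≡ suc y
  rim-end h i rewrite rim-ends i with hatFirst (m ↑ʳ i) | h
  ... | false | false = _ , refl
  ... | false | true  = _ , refl
  ... | true  | false = _ , refl
  ... | true  | true  = _ , refl

  -- Otherwise swapping creates a loop.
  no-through : ∀ h {e f} → bond e ≡ bond f → end h e ≢ end (not h) f
  no-through h {e} {f} same through =
    Iso.loopless 4≤m (swapEnds h e f) (swapEnds-≅ h same) e (end h e)
      (inj₁ (refl , trans (cong (end (not h)) (transpose-matchˡ e f)) (sym through)))

  -- Otherwise swapping creates a double spoke.
  spoke-meets-rim : ∀ h {i j} → bond (i ↑ˡ m) ≡ bond (m ↑ʳ j) →
    end h (i ↑ˡ m) ≡ zero → end (not h) (m ↑ʳ j) ≡ suc i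
  spoke-meets-rim h {i} {j} same from-hub with rim-end (not h) j
  ... | y , end≡y with y ≟ i
  ...   | yes refl = end≡y
  ...   | no  y≢i  = contradiction
    (↑ˡ-injective m y i (Iso.simple 4≤m (swapEnds h (i ↑ˡ m) (m ↑ʳ j)) (swapEnds-≅ h same)
      {y ↑ˡ m} {i ↑ˡ m} old new)) y≢i
    where
    new : Joins (ends (swapEnds h (i ↑ˡ m) (m ↑ʳ j)) (i ↑ˡ m)) zero (suc y)
    new = inj₁ (from-hub , trans (cong (end (not h)) (transpose-matchˡ (i ↑ˡ m) (m ↑ʳ j))) end≡y)
    old : Joins (ends (swapEnds h (i ↑ˡ m) (m ↑ʳ j)) (y ↑ˡ m)) zero (suc y)
    old rewrite transpose-mismatch {i = i ↑ˡ m} {m ↑ʳ j} {y ↑ˡ m}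
      (y≢i ∘ ↑ˡ-injective m y i) (spoke≢rim y j) = hub-or h y

  paired-spokes⇒no-rim : ∀ {i i′} → i ≢ i′ → bond (i ↑ˡ m) ≡ bond (i′ ↑ˡ m) →
    ∀ j → bond (i ↑ˡ m) ≢ bond (m ↑ʳ j)
  paired-spokes⇒no-rim {i} {i′} i≢i′ same j same′ with hub-or true i | hub-or true i′
  ... | inj₁ (p , _) | inj₁ (q , _) = i≢i′ (suc-injective (trans
    (sym (spoke-meets-rim true same′ p)) (spoke-meets-rim true (trans (sym same) same′) q)))
  ... | inj₂ (_ , p) | inj₂ (_ , q) = i≢i′ (suc-injective (trans
    (sym (spoke-meets-rim false same′ p)) (spoke-meets-rim false (trans (sym same) same′) q)))
  ... | inj₁ (p , _) | inj₂ (_ , q) = no-through true same (trans p (sym q))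
  ... | inj₂ (_ , p) | inj₁ (q , _) = no-through false same (trans p (sym q))

  -- Exchanging the heads of two equally oriented rim edges i and j detaches the arc from
  -- i + 1 to j.
  module Parallel {i j : Fin m} (i<j : toℕ i < toℕ j)
                  (same-bond : bond (m ↑ʳ i) ≡ bond (m ↑ʳ j))
                  (same-hat : hatFirst (m ↑ʳ i) ≡ hatFirst (m ↑ʳ j)) where

    h : Bool
    h = hatFirst (m ↑ʳ i)

    H : Graph
    H = swapEnds h (m ↑ʳ i) (m ↑ʳ j)

    open Iso 4≤m H (swapEnds-≅ h same-bond)

    Arc : Fin (suc m) → Set
    Arc zero    = ⊥
    Arc (suc l) = toℕ i < toℕ l × toℕ l ≤ toℕ j

    arc-next : ∀ l → l ≢ j → Arc (suc l) → Arc (suc (cnext l))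
    arc-next l l≢j (i<l , l≤j) with cnext-cases l
    ... | inj₁ p rewrite p =
      ℕ.m<n⇒m<1+n i<l , ℕ.≤∧≢⇒< l≤j (l≢j ∘ toℕ-injective)
    ... | inj₂ (_ , p) = contradiction (toℕ-injective (ℕ.≤-antisym l≤j
      (ℕ.≤-pred (subst (toℕ j <_) (sym p) (toℕ<n j))))) l≢j

    arc-prev : ∀ l → l ≢ i → Arc (suc (cnext l)) → Arc (suc l)
    arc-prev l l≢i (i<l , l≤j) with cnext-cases l
    ... | inj₁ p rewrite p =
      ℕ.≤∧≢⇒< (ℕ.≤-pred i<l) (l≢i ∘ sym ∘ toℕ-injective) , ℕ.<⇒≤ l≤j
    ... | inj₂ (p , _) rewrite p = contradiction i<l ℕ.n≮0

    arc-start : Arc (suc (cnext i))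
    arc-start with cnext-cases i
    ... | inj₁ p rewrite p = ℕ.n<1+n _ , i<j
    ... | inj₂ (_ , p) = contradiction (ℕ.<-≤-trans (toℕ<n j)
      (subst (_≤ toℕ j) p i<j)) (ℕ.<-irrefl refl)

    after-arc : ¬ Arc (suc (cnext j))
    after-arc (i<l , l≤j) with cnext-cases j
    ... | inj₁ p       = ℕ.1+n≰n (subst (_≤ toℕ j) p l≤j)
    ... | inj₂ (p , _) = ℕ.n≮0 (subst (toℕ i <_) p i<l)

    tail-h : ∀ {l} → h ≡ hatFirst (m ↑ʳ l) → end h (m ↑ʳ l) ≡ suc l
    tail-h {l} eq = trans (cong (λ b → labelled (hatFirst (m ↑ʳ l)) b (wheelEnds m (m ↑ʳ l))) eq)
      (trans (labelled-same (hatFirst (m ↑ʳ l))) (cong proj₁ (rim-ends l)))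

    head-h : ∀ {l} → h ≡ hatFirst (m ↑ʳ l) → end (not h) (m ↑ʳ l) ≡ suc (cnext l)
    head-h {l} eq = trans
      (cong (λ b → labelled (hatFirst (m ↑ʳ l)) (not b) (wheelEnds m (m ↑ʳ l))) eq)
      (trans (labelled-opp (hatFirst (m ↑ʳ l))) (cong proj₂ (rim-ends l)))

    τ = PC.transpose (m ↑ʳ i) (m ↑ʳ j)

    τ-spoke : ∀ l → τ (l ↑ˡ m) ≡ l ↑ˡ m
    τ-spoke l = transpose-mismatch (spoke≢rim l i) (spoke≢rim l j)

    closed : ∀ e {p q} → Joins (ends H e) (suc p) (suc q) → Arc (suc p) → Arc (suc q)
    closed e joined arc with wheelEdge m e
    closed e joined arc | spoke l rewrite τ-spoke l with hub-or h l | joined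
    ... | inj₁ (z , _) | inj₁ (s , _) with () ← trans (sym z) s
    ... | inj₁ (z , _) | inj₂ (s , _) with () ← trans (sym z) s
    ... | inj₂ (_ , z) | inj₁ (_ , s) with () ← trans (sym z) s
    ... | inj₂ (_ , z) | inj₂ (_ , s) with () ← trans (sym z) s
    closed e joined arc | rim l with l ≟ i | l ≟ j
    ... | yes refl | _
      rewrite transpose-matchˡ (m ↑ʳ i) (m ↑ʳ j) | tail-h {i} refl | head-h same-hat
      with joined
    ...   | inj₁ (refl , refl) = contradiction (proj₁ arc) (ℕ.<-irrefl refl)
    ...   | inj₂ (refl , refl) = contradiction arc after-arc
    closed e joined arc | rim l | no _ | yes refl
      rewrite transpose-matchʳ (m ↑ʳ i) (m ↑ʳ j) | tail-h same-hat | head-h {i} refl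
      with joined
    ...   | inj₁ (refl , refl) = arc-start
    ...   | inj₂ (refl , refl) = i<j , ℕ.≤-refl
    closed e joined arc | rim l | no l≢i | no l≢j
      rewrite transpose-mismatch {i = m ↑ʳ i} {m ↑ʳ j} {m ↑ʳ l}
        (l≢i ∘ ↑ʳ-injective m l i) (l≢j ∘ ↑ʳ-injective m l j)
      with subst (λ p → Joins (end h (m ↑ʳ l) , end (not h) (m ↑ʳ l)) (proj₁ p) (proj₂ p))
             (rim-ends l) (labelled-joins (hatFirst (m ↑ʳ l)) h (wheelEnds m (m ↑ʳ l)))
         | joined
    ...   | inj₁ (a , b) | inj₁ (a′ , b′) =
      subst Arc (trans (sym b) b′) (arc-next l l≢j (subst Arc (trans (sym a′) a) arc))
    ...   | inj₁ (a , b) | inj₂ (a′ , b′) =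
      subst Arc (trans (sym a) a′) (arc-prev l l≢i (subst Arc (trans (sym b′) b) arc))
    ...   | inj₂ (a , b) | inj₁ (a′ , b′) =
      subst Arc (trans (sym b) b′) (arc-prev l l≢i (subst Arc (trans (sym a′) a) arc))
    ...   | inj₂ (a , b) | inj₂ (a′ , b′) =
      subst Arc (trans (sym a) a′) (arc-next l l≢j (subst Arc (trans (sym b′) b) arc))

    hub-fixed : to zero ≡ zero
    hub-fixed = hub-image zero λ
      { zero    v≢0 → contradiction refl v≢0
      ; (suc l) _   → l ↑ˡ m , spoke-joins l }
      where
      spoke-joins : ∀ l → Joins (ends H (l ↑ˡ m)) zero (suc l)
      spoke-joins l rewrite τ-spoke l = hub-or h l

    arc-image : ∀ l → Arc (from (suc l)) → Arc (from (suc (cnext l)))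
    arc-image l arc with from (suc l) in eq | from (suc (cnext l)) in eq′
    ... | suc p | zero  with () ← trans (sym hub-fixed)
                               (trans (cong to (sym eq′)) (strictlyInverseˡ (suc (cnext l))))
    ... | suc p | suc q
      with edge-from-wheel {m ↑ʳ l} {suc p} {suc q} (subst₂ (Joins (wheelEnds m (m ↑ʳ l)))
        (trans (sym (strictlyInverseˡ (suc l))) (cong to eq))
        (trans (sym (strictlyInverseˡ (suc (cnext l)))) (cong to eq′))
        (inj₁ (cong proj₁ (rim-ends l) , cong proj₂ (rim-ends l))))
    ...   | e , joined = closed e joined arc

    impossible : ⊥
    impossible with to (suc i) in eqi | to (suc j) in eqj
    ... | zero | _ with () ← trans (sym (strictlyInverseʳ (suc i)))
                        (trans (cong from (trans eqi (sym hub-fixed))) (strictlyInverseʳ zero))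
    ... | _ | zero with () ← trans (sym (strictlyInverseʳ (suc j)))
                        (trans (cong from (trans eqj (sym hub-fixed))) (strictlyInverseʳ zero))
    ... | suc p | suc q = ℕ.<-irrefl refl (proj₁ (subst Arc
      (trans (cong from (sym eqi)) (strictlyInverseʳ (suc i)))
      (cnext-closed (λ l → Arc (from (suc l))) arc-image {q}
        (subst Arc (sym (trans (cong from (sym eqj)) (strictlyInverseʳ (suc j))))
          (i<j , ℕ.≤-refl)) p)))

  rim-labels-distinct : ∀ i j → bond (m ↑ʳ i) ≡ bond (m ↑ʳ j) →
    hatFirst (m ↑ʳ i) ≡ hatFirst (m ↑ʳ j) → i ≡ j
  rim-labels-distinct i j same-bond same-hat with ℕ.<-cmp (toℕ i) (toℕ j)
  ... | tri≈ _ i≡j _ = toℕ-injective i≡j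
  ... | tri< i<j _ _ = contradiction (Parallel.impossible i<j same-bond same-hat) λ ()
  ... | tri> _ _ j<i =
    contradiction (Parallel.impossible j<i (sym same-bond) (sym same-hat)) λ ()

  bound : m ≤ k ⊎ 2 + m ≤ k * 2
  bound with ℕ.≤-<-connex m k
  ... | inj₁ m≤k = inj₁ m≤k
  ... | inj₂ k<m with pigeonhole k<m (λ i → bond (i ↑ˡ m))
  ...   | i , i′ , i<i′ , same = inj₂ (two-per-colour
    (λ j → bond (m ↑ʳ j)) (λ j → hatFirst (m ↑ʳ j)) (bond (i ↑ˡ m))
    (paired-spokes⇒no-rim (λ i≡i′ → ℕ.<⇒≢ i<i′ (cong toℕ i≡i′)) same) rim-labels-distinct)

-- Upper bound

δ : ℕ → ℕ → ℕ
δ zero    zero    = 1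
δ zero    (suc y) = 0
δ (suc x) zero    = 0
δ (suc x) (suc y) = δ x y

δ-refl : ∀ x → δ x x ≡ 1
δ-refl zero    = refl
δ-refl (suc x) = δ-refl x

δ-≢ : ∀ {x y} → x ≢ y → δ x y ≡ 0
δ-≢ {zero}  {zero}  x≢y = contradiction refl x≢y
δ-≢ {zero}  {suc y} x≢y = refl
δ-≢ {suc x} {zero}  x≢y = refl
δ-≢ {suc x} {suc y} x≢y = δ-≢ (x≢y ∘ cong suc)

δ-comm : ∀ x y → δ x y ≡ δ y x
δ-comm zero    zero    = refl
δ-comm zero    (suc y) = refl
δ-comm (suc x) zero    = refl
δ-comm (suc x) (suc y) = δ-comm x y

1≤δ⇒≡ : ∀ x y → 1 ≤ δ x y → x ≡ y
1≤δ⇒≡ zero    zero    _ = refl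
1≤δ⇒≡ (suc x) (suc y) p = cong suc (1≤δ⇒≡ x y p)

1≤+⇒⊎ : ∀ x {y} → 1 ≤ x + y → 1 ≤ x ⊎ 1 ≤ y
1≤+⇒⊎ zero    p = inj₂ p
1≤+⇒⊎ (suc x) p = inj₁ (s≤s z≤n)

1≤*⇒× : ∀ x {y} → 1 ≤ x * y → 1 ≤ x × 1 ≤ y
1≤*⇒× (suc x) {suc y} p = s≤s z≤n , s≤s z≤n
1≤*⇒× (suc x) {zero}  p = contradiction (subst (1 ≤_) (ℕ.*-zeroʳ x) p) λ ()

occurs : Bool → Bool → ℕ → ℕ → ℕ
occurs false false x y = δ x y
occurs true  true  x y = δ x y
occurs false true  x y = 0
occurs true  false x y = 0

ind-occurs : ∀ {n} l h (x y : Fin n) →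
  ind (⌊ suc x ≟ suc y ⌋ ∧ ⌊ l Bool.≟ h ⌋) ≡ occurs l h (toℕ x) (toℕ y)
ind-occurs l h x y with suc x ≟ suc y
ind-occurs false false x y | yes refl = sym (δ-refl (toℕ x))
ind-occurs false true  x y | yes refl = refl
ind-occurs true  false x y | yes refl = refl
ind-occurs true  true  x y | yes refl = sym (δ-refl (toℕ x))
ind-occurs false false x y | no x≢y = sym (δ-≢ (x≢y ∘ cong suc ∘ toℕ-injective))
ind-occurs false true  x y | no x≢y = refl
ind-occurs true  false x y | no x≢y = refl
ind-occurs true  true  x y | no x≢y = sym (δ-≢ (x≢y ∘ cong suc ∘ toℕ-injective))

module WheelPot (K′ c : ℕ) (c≤K′ : c ≤ K′) where

  K m : ℕ
  K = suc K′
  m = suc (K + c)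

  rimLabels : Bool → ℕ → ℕ → ℕ
  rimLabels false l b = δ l b + δ l 0 * δ b 0
  rimLabels true  l b = δ l (suc b) + δ l K * δ b c

  -- Tile 0 is the hub and tile l + 1 is the rim tile of level l; bond 0 is carried by the
  -- spokes, and bond b + 1 leads from level b to level b + 1 (or, for b = c, also to level K).
  labels : ℕ → ℕ → Bool → ℕ
  labels zero    zero    false = m
  labels zero    zero    true  = 0
  labels zero    (suc b) h     = 0
  labels (suc l) zero    false = 0
  labels (suc l) zero    true  = 1
  labels (suc l) (suc b) h     = rimLabels h l b

  labels-out : ∀ {l b} → 1 ≤ rimLabels false l b → l ≡ b
  labels-out {l} {b} p with 1≤+⇒⊎ (δ l b) p
  ... | inj₁ q = 1≤δ⇒≡ l b q
  ... | inj₂ q = let q₁ , q₂ = 1≤*⇒× (δ l 0) q in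
    trans (1≤δ⇒≡ l 0 q₁) (sym (1≤δ⇒≡ b 0 q₂))

  labels-in : ∀ {l b} → 1 ≤ rimLabels true l b → l ≡ suc b ⊎ (l ≡ K × b ≡ c)
  labels-in {l} {b} p with 1≤+⇒⊎ (δ l (suc b)) p
  ... | inj₁ q = inj₁ (1≤δ⇒≡ l (suc b) q)
  ... | inj₂ q = let q₁ , q₂ = 1≤*⇒× (δ l K) q in
    inj₂ (1≤δ⇒≡ l K q₁ , 1≤δ⇒≡ b c q₂)

  rimTile-distinct : ∀ (l l′ : Fin (suc K)) → toℕ l < K → l ≢ l′ →
    ¬ SameTile {suc K} (λ a h → labels (suc (toℕ l)) (toℕ a) h)
                       (λ a h → labels (suc (toℕ l′)) (toℕ a) h)
  rimTile-distinct l l′ l<K l≢l′ same = l≢l′ (toℕ-injective (sym (labels-out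
    (subst (λ b → 1 ≤ rimLabels false (toℕ l′) b) (toℕ-fromℕ< l<K)
      (subst (1 ≤_) (same (suc (fromℕ< l<K)) false)
        (ℕ.≤-trans (ℕ.≤-reflexive (sym (trans (cong (δ (toℕ l)) (toℕ-fromℕ< l<K))
          (δ-refl (toℕ l))))) (ℕ.m≤m+n _ _)))))))

  pot : Pot (suc K)
  pot = record
    { ntiles   = suc (suc K)
    ; tile     = λ t a h → labels (toℕ t) (toℕ a) h
    ; distinct = distinct-tiles
    }
    where
    distinct-tiles : ∀ (s t : Fin (suc (suc K))) → s ≢ t →
      ¬ SameTile {suc K} (λ a h → labels (toℕ s) (toℕ a) h) (λ a h → labels (toℕ t) (toℕ a) h)
    distinct-tiles zero    zero    s≢t same = s≢t refl
    distinct-tiles zero    (suc t) s≢t same with () ← same zero false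
    distinct-tiles (suc s) zero    s≢t same with () ← same zero false
    distinct-tiles (suc s) (suc t) s≢t same with ℕ.m≤n⇒m<n∨m≡n (ℕ.≤-pred (toℕ<n s))
    ... | inj₁ s<K = rimTile-distinct s t s<K (s≢t ∘ cong suc) same
    ... | inj₂ s≡K with ℕ.m≤n⇒m<n∨m≡n (ℕ.≤-pred (toℕ<n t))
    ...   | inj₁ t<K = rimTile-distinct t s t<K (s≢t ∘ cong suc ∘ sym) (λ a h → sym (same a h))
    ...   | inj₂ t≡K = s≢t (cong suc (toℕ-injective (trans s≡K (sym t≡K))))

  level rimBond : ℕ → ℕ
  level p with p ℕ.≤? K
  ... | yes _ = p
  ... | no  _ = m ∸ p
  rimBond p with p ℕ.<? K
  ... | yes _ = p
  ... | no  _ = (K + c) ∸ p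

  rimHat : ℕ → Bool
  rimHat p with p ℕ.<? K
  ... | yes _ = false
  ... | no  _ = true

  level-lo : ∀ {p} → p ≤ K → level p ≡ p
  level-lo {p} p≤K with p ℕ.≤? K
  ... | yes _   = refl
  ... | no  p≰K = contradiction p≤K p≰K

  level-hi : ∀ {p} → K < p → level p ≡ m ∸ p
  level-hi {p} K<p with p ℕ.≤? K
  ... | yes p≤K = contradiction K<p (ℕ.≤⇒≯ p≤K)
  ... | no  _   = refl

  rimBond-lo : ∀ {p} → p < K → rimBond p ≡ p
  rimBond-lo {p} p<K with p ℕ.<? K
  ... | yes _   = refl
  ... | no  p≮K = contradiction p<K p≮K

  rimBond-hi : ∀ {p} → K ≤ p → rimBond p ≡ (K + c) ∸ p
  rimBond-hi {p} K≤p with p ℕ.<? K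
  ... | yes p<K = contradiction p<K (ℕ.≤⇒≯ K≤p)
  ... | no  _   = refl

  rimHat-lo : ∀ {p} → p < K → rimHat p ≡ false
  rimHat-lo {p} p<K with p ℕ.<? K
  ... | yes _   = refl
  ... | no  p≮K = contradiction p<K p≮K

  rimHat-hi : ∀ {p} → K ≤ p → rimHat p ≡ true
  rimHat-hi {p} K≤p with p ℕ.<? K
  ... | yes p<K = contradiction p<K (ℕ.≤⇒≯ K≤p)
  ... | no  _   = refl

  c<K : c < K
  c<K = s≤s c≤K′

  hi-bond≤c : ∀ {p} → K ≤ p → (K + c) ∸ p ≤ c
  hi-bond≤c {p} K≤p = subst ((K + c) ∸ p ≤_) (ℕ.m+n∸m≡n K c) (ℕ.∸-monoʳ-≤ (K + c) K≤p)

  hi-level≤c : ∀ {p} → K < p → m ∸ p ≤ c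
  hi-level≤c {suc p} K<p = hi-bond≤c (ℕ.≤-pred K<p)

  level≤K : ∀ p → level p ≤ K
  level≤K p with ℕ.≤-<-connex p K
  ... | inj₁ p≤K rewrite level-lo p≤K = p≤K
  ... | inj₂ K<p rewrite level-hi K<p = ℕ.≤-trans (hi-level≤c K<p) (ℕ.<⇒≤ c<K)

  rimBond<K : ∀ p → rimBond p < K
  rimBond<K p with ℕ.<-≤-connex p K
  ... | inj₁ p<K rewrite rimBond-lo p<K = p<K
  ... | inj₂ K≤p rewrite rimBond-hi K≤p = ℕ.≤-<-trans (hi-bond≤c K≤p) c<K

  labels-inner : ∀ h {i} b → i < K + c → b < K →
    occurs (rimHat (suc i)) h (rimBond (suc i)) b + occurs (not (rimHat i)) h (rimBond i) b
    ≡ rimLabels h (level (suc i)) b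
  labels-inner h {i} b i<m b<K with ℕ.<-cmp (suc i) K
  labels-inner h {i} b i<m b<K | tri< p<K _ _
    rewrite rimHat-lo p<K | rimBond-lo p<K | rimHat-lo (ℕ.<⇒≤ p<K) | rimBond-lo (ℕ.<⇒≤ p<K)
          | level-lo (ℕ.<⇒≤ p<K) with h
  ... | false = refl
  ... | true  rewrite δ-≢ (ℕ.<⇒≢ (ℕ.≤-pred p<K)) = sym (ℕ.+-identityʳ _)
  labels-inner h {i} b i<m b<K | tri≈ _ refl _
    rewrite rimHat-hi (ℕ.≤-refl {K}) | rimBond-hi (ℕ.≤-refl {K}) | ℕ.m+n∸m≡n K c
          | rimHat-lo (ℕ.≤-refl {K}) | rimBond-lo (ℕ.≤-refl {K})
          | level-lo (ℕ.≤-refl {K}) with h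
  ... | false rewrite δ-≢ (ℕ.<⇒≢ b<K ∘ sym) = refl
  ... | true  rewrite δ-refl K′ = trans (ℕ.+-comm (δ c b) _)
    (cong (δ K′ b +_) (trans (δ-comm c b) (sym (ℕ.+-identityʳ _))))
  labels-inner h {i} b i<m b<K | tri> _ _ K<p
    rewrite rimHat-hi (ℕ.<⇒≤ K<p) | rimBond-hi (ℕ.<⇒≤ K<p)
          | rimHat-hi (ℕ.≤-pred K<p) | rimBond-hi (ℕ.≤-pred K<p)
          | level-hi K<p with h
  ... | false rewrite ℕ.+-∸-assoc 1 {K′ + c} {i} (ℕ.≤-pred i<m) = sym (ℕ.+-identityʳ _)
  ... | true  rewrite δ-≢ {(K + c) ∸ i} {K} (ℕ.<⇒≢ (ℕ.≤-<-trans (hi-level≤c K<p) c<K))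
                    | ℕ.+-∸-assoc 1 {K′ + c} {i} (ℕ.≤-pred i<m) = refl

  labels-zero : ∀ h b →
    occurs (rimHat 0) h (rimBond 0) b + occurs (not (rimHat (K + c))) h (rimBond (K + c)) b
    ≡ rimLabels h (level 0) b
  labels-zero h b
    rewrite rimHat-hi (ℕ.m≤m+n K c) | rimBond-hi (ℕ.m≤m+n K c) | ℕ.n∸n≡0 (K + c) with h
  ... | false = cong (δ 0 b +_) (trans (δ-comm 0 b) (sym (ℕ.+-identityʳ _)))
  ... | true  = refl

  W : Graph
  W = wheel (suc m)

  wheelTile : Fin (suc m) → Fin (suc (suc K))
  wheelTile zero    = zero
  wheelTile (suc i) = suc (fromℕ< (s≤s (level≤K (toℕ i))))

  toℕ-wheelTile : ∀ i → toℕ (wheelTile (suc i)) ≡ suc (level (toℕ i))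
  toℕ-wheelTile i = cong suc (toℕ-fromℕ< _)

  wheelBond : Fin (m + m) → Fin (suc K)
  wheelBond e = [ (λ _ → zero) , (λ i → suc (fromℕ< (rimBond<K (toℕ i)))) ]′ (splitAt m e)

  wheelHat : Fin (m + m) → Bool
  wheelHat e = [ (λ _ → false) , (λ i → rimHat (toℕ i)) ]′ (splitAt m e)

  wheelBond-spoke : ∀ i → wheelBond (i ↑ˡ m) ≡ zero
  wheelBond-spoke i rewrite splitAt-↑ˡ m i m = refl

  wheelBond-rim : ∀ i → wheelBond (m ↑ʳ i) ≡ suc (fromℕ< (rimBond<K (toℕ i)))
  wheelBond-rim i rewrite splitAt-↑ʳ m m i = refl

  wheelEnd-spoke : ∀ h i →
    labelled (wheelHat (i ↑ˡ m)) h (wheelEnds m (i ↑ˡ m)) ≡ labelled false h (zero , suc i)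
  wheelEnd-spoke h i rewrite splitAt-↑ˡ m i m = refl

  wheelEnd-rim : ∀ h i → labelled (wheelHat (m ↑ʳ i)) h (wheelEnds m (m ↑ʳ i))
                       ≡ labelled (rimHat (toℕ i)) h (suc i , suc (cnext i))
  wheelEnd-rim h i rewrite splitAt-↑ʳ m m i = refl

  rim-count : ∀ j (b : Fin K) h → Σ[< m ] (λ i →
      ind (⌊ labelled (rimHat (toℕ i)) h (suc i , suc (cnext i)) ≟ suc j ⌋
         ∧ ⌊ suc (fromℕ< (rimBond<K (toℕ i))) ≟ suc b ⌋))
    ≡ rimLabels h (level (toℕ j)) (toℕ b)
  rim-count j b h with injective⇒surjective {f = cnext {m}} ℕ.≤-refl cnext-injective j
  ... | i , cnexti≡j = begin
    Σ[< m ] (λ i → ind (⌊ labelled (rimHat (toℕ i)) h (suc i , suc (cnext i)) ≟ suc j ⌋ ∧ B i))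
      ≡⟨ Σ-cong (λ i → sym
           (half-edge-count (rimHat (toℕ i)) h (suc i , suc (cnext i)) (suc j) (B i))) ⟩
    Σ[< m ] (λ i → first i + second i)
      ≡⟨ Σ-distrib-+ first second ⟩
    Σ[< m ] first + Σ[< m ] second
      ≡⟨ cong₂ _+_
           (Σ-single {f = first} j (λ i′ i′≢j → off (suc i′ ≟ suc j)
             (B i′ ∧ ⌊ rimHat (toℕ i′) Bool.≟ h ⌋) (i′≢j ∘ suc-injective)))
           (Σ-single {f = second} i (λ i′ i′≢i → off (suc (cnext i′) ≟ suc j)
             (B i′ ∧ ⌊ not (rimHat (toℕ i′)) Bool.≟ h ⌋)
             (λ eq → i′≢i (cnext-injective (trans (suc-injective eq) (sym cnexti≡j)))))) ⟩
    first j + second i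
      ≡⟨ cong₂ _+_ (on (suc j ≟ suc j) (B j ∧ ⌊ rimHat (toℕ j) Bool.≟ h ⌋) refl)
           (on (suc (cnext i) ≟ suc j) (B i ∧ ⌊ not (rimHat (toℕ i)) Bool.≟ h ⌋)
             (cong suc cnexti≡j)) ⟩
    ind (B j ∧ ⌊ rimHat (toℕ j) Bool.≟ h ⌋) + ind (B i ∧ ⌊ not (rimHat (toℕ i)) Bool.≟ h ⌋)
      ≡⟨ cong₂ _+_ (occ (rimHat (toℕ j)) j) (occ (not (rimHat (toℕ i))) i) ⟩
    occurs (rimHat (toℕ j)) h (rimBond (toℕ j)) (toℕ b)
      + occurs (not (rimHat (toℕ i))) h (rimBond (toℕ i)) (toℕ b)
      ≡⟨ final ⟩
    rimLabels h (level (toℕ j)) (toℕ b)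
      ∎
    where
    open ≡-Reasoning
    B : Fin m → Bool
    B i = ⌊ suc (fromℕ< (rimBond<K (toℕ i))) ≟ suc b ⌋
    first second : Fin m → ℕ
    first  i = ind (⌊ suc i ≟ suc j ⌋ ∧ B i ∧ ⌊ rimHat (toℕ i) Bool.≟ h ⌋)
    second i = ind (⌊ suc (cnext i) ≟ suc j ⌋ ∧ B i ∧ ⌊ not (rimHat (toℕ i)) Bool.≟ h ⌋)
    off : ∀ {A : Set} (a? : Dec A) b → ¬ A → ind (⌊ a? ⌋ ∧ b) ≡ 0
    off a? b ¬a = cong (λ x → ind (x ∧ b)) (⌊⌋-false a? ¬a)
    on : ∀ {A : Set} (a? : Dec A) b → A → ind (⌊ a? ⌋ ∧ b) ≡ ind b
    on a? b a = cong (λ x → ind (x ∧ b)) (⌊⌋-true a? a)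
    occ : ∀ l i → ind (B i ∧ ⌊ l Bool.≟ h ⌋) ≡ occurs l h (rimBond (toℕ i)) (toℕ b)
    occ l i = trans (ind-occurs l h (fromℕ< (rimBond<K (toℕ i))) b)
      (cong (λ x → occurs l h x (toℕ b)) (toℕ-fromℕ< _))
    final : occurs (rimHat (toℕ j)) h (rimBond (toℕ j)) (toℕ b)
      + occurs (not (rimHat (toℕ i))) h (rimBond (toℕ i)) (toℕ b)
      ≡ rimLabels h (level (toℕ j)) (toℕ b)
    final with cnext-cases i
    ... | inj₁ p rewrite trans (cong toℕ (sym cnexti≡j)) p =
      labels-inner h (toℕ b)
        (ℕ.≤-pred (subst (_< m) (trans (cong toℕ (sym cnexti≡j)) p) (toℕ<n j))) (toℕ<n b)
    ... | inj₂ (p , q) rewrite trans (cong toℕ (sym cnexti≡j)) p | ℕ.suc-injective q =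
      labels-zero h (toℕ b)

  wheel-realization : Realization pot W
  wheel-realization = realization pot W wheelTile wheelBond wheelHat λ v a h → trans
    (Σ-split m (λ e → ind (⌊ labelled (wheelHat e) h (wheelEnds m e) ≟ v ⌋ ∧ ⌊ wheelBond e ≟ a ⌋)))
    (trans (cong₂ _+_
      (Σ-cong (λ i → cong₂ (λ x y → ind (⌊ x ≟ v ⌋ ∧ ⌊ y ≟ a ⌋))
        (wheelEnd-spoke h i) (wheelBond-spoke i)))
      (Σ-cong (λ i → cong₂ (λ x y → ind (⌊ x ≟ v ⌋ ∧ ⌊ y ≟ a ⌋))
        (wheelEnd-rim h i) (wheelBond-rim i))))
      (counts v a h))
    where
    spokes rims : Fin (suc m) → Fin (suc K) → Bool → ℕ
    spokes v a h = Σ[< m ] (λ i → ind (⌊ labelled false h (zero , suc i) ≟ v ⌋ ∧ ⌊ zero ≟ a ⌋))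
    rims v a h = Σ[< m ] (λ i →
      ind (⌊ labelled (rimHat (toℕ i)) h (suc i , suc (cnext i)) ≟ v ⌋
         ∧ ⌊ suc (fromℕ< (rimBond<K (toℕ i))) ≟ a ⌋))
    no-rim-at-hub : ∀ a h → rims zero a h ≡ 0
    no-rim-at-hub a h = Σ-zero (λ i → not-hub (rimHat (toℕ i)) h i)
      where
      not-hub : ∀ l h i → ind (⌊ labelled l h (suc i , suc (cnext i)) ≟ zero ⌋
         ∧ ⌊ suc (fromℕ< (rimBond<K (toℕ i))) ≟ a ⌋) ≡ 0
      not-hub false false i = refl
      not-hub false true  i = refl
      not-hub true  false i = refl
      not-hub true  true  i = refl
    no-spoke : ∀ v b h → spokes v (suc b) h ≡ 0
    no-spoke v b h = Σ-zero (λ i → cong ind (Bool.∧-zeroʳ ⌊ labelled false h (zero , suc i) ≟ v ⌋))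
    no-rim : ∀ v h → rims v zero h ≡ 0
    no-rim v h = Σ-zero (λ i → cong ind
      (Bool.∧-zeroʳ ⌊ labelled (rimHat (toℕ i)) h (suc i , suc (cnext i)) ≟ v ⌋))
    counts : ∀ v a h → spokes v a h + rims v a h ≡ labels (toℕ (wheelTile v)) (toℕ a) h
    counts zero zero false = trans (cong₂ _+_ (Σ-const-1 m) (no-rim-at-hub zero false))
      (ℕ.+-identityʳ m)
    counts zero zero true  = cong₂ _+_ (Σ-zero {m} (λ _ → refl)) (no-rim-at-hub zero true)
    counts zero (suc b) h  = cong₂ _+_ (no-spoke zero b h) (no-rim-at-hub (suc b) h)
    counts (suc j) zero false = cong₂ _+_ (Σ-zero {m} (λ _ → refl)) (no-rim (suc j) false)
    counts (suc j) zero true  = cong₂ _+_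
      (trans (Σ-single j (λ i i≢j → cong (λ x → ind (x ∧ true))
          (⌊⌋-false (suc i ≟ suc j) (i≢j ∘ suc-injective))))
        (cong (λ x → ind (x ∧ true)) (⌊⌋-true (suc j ≟ suc j) refl)))
      (no-rim (suc j) true)
    counts (suc j) (suc b) h = trans
      (cong₂ _+_ (no-spoke (suc j) b h) (rim-count j b h))
      (cong (λ l → rimLabels h l (toℕ b)) (sym (toℕ-fromℕ< _)))

module Uniqueness (K′ c : ℕ) (c≤K′ : c ≤ K′) {H : Graph} where

  open WheelPot K′ c c≤K′

  module _ (S : Realization pot H) where

    open HalfEdges S

    kind : Fin (order H) → ℕ
    kind v = toℕ (tileOf v)

    bondℕ : Fin (size H) → ℕ
    bondℕ e = toℕ (bond e)

    leave : ∀ {v t} a h → a < suc K → kind v ≡ t → 1 ≤ labels t a h →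
            ∃ λ e → end h e ≡ v × bondℕ e ≡ a
    leave {v} a h a<K refl 1≤ with half-edge v (fromℕ< a<K) h
      (subst (λ a → 1 ≤ labels (kind v) a h) (sym (toℕ-fromℕ< a<K)) 1≤)
    ... | e , p , q = e , p , trans (cong toℕ q) (toℕ-fromℕ< a<K)

    unique : ∀ {v t a} h → kind v ≡ t → labels t a h ≤ 1 → ∀ {e f} →
      end h e ≡ v → bondℕ e ≡ a → end h f ≡ v → bondℕ f ≡ a → e ≡ f
    unique h refl ≤1 {e} p refl p′ q′ =
      half-edge-unique h ≤1 p refl p′ (toℕ-injective q′)

    out-kind : ∀ {e b} → bondℕ e ≡ suc b → kind (end false e) ≡ suc b
    out-kind {e} {b} eq with label-in-tile false e
    ... | 1≤ rewrite eq with kind (end false e)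
    ...   | suc l = cong suc (labels-out 1≤)

    in-kind : ∀ {e b} → bondℕ e ≡ suc b →
              kind (end true e) ≡ suc (suc b) ⊎ (kind (end true e) ≡ suc K × b ≡ c)
    in-kind {e} {b} eq with label-in-tile true e
    ... | 1≤ rewrite eq with kind (end true e)
    ...   | suc l with labels-in {l} 1≤
    ...     | inj₁ p       = inj₁ (cong suc p)
    ...     | inj₂ (p , q) = inj₂ (cong suc p , q)

    spoke-out : ∀ {e} → bondℕ e ≡ 0 → kind (end false e) ≡ 0
    spoke-out {e} eq with label-in-tile false e
    ... | 1≤ rewrite eq with kind (end false e)
    ...   | zero = refl

    spoke-in : ∀ {e} → bondℕ e ≡ 0 → ∃ λ l → kind (end true e) ≡ suc l
    spoke-in {e} eq with label-in-tile true e
    ... | 1≤ rewrite eq with kind (end true e)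
    ...   | suc l = l , refl

    kind≤ : ∀ v {l} → kind v ≡ suc l → l ≤ K
    kind≤ v {l} eq = ℕ.≤-pred (ℕ.≤-pred (subst (_< suc (suc K)) eq (toℕ<n (tileOf v))))

    climb : ∀ d {v l} → l + d ≡ K → kind v ≡ suc l → ∃ λ z → kind z ≡ suc K
    climb zero    {v} {l} eq kv =
      v , trans kv (cong suc (trans (sym (ℕ.+-identityʳ l)) eq))
    climb (suc d) {v} {l} eq kv
      with leave (suc l) false (s≤s (ℕ.m+n≤o⇒m≤o (suc l)
             (ℕ.≤-reflexive (trans (sym (ℕ.+-suc l d)) eq)))) kv
             (ℕ.≤-trans (ℕ.≤-reflexive (sym (δ-refl l))) (ℕ.m≤m+n _ _))
    ... | e , _ , be with in-kind {e} be
    ...   | inj₁ p       = climb d (trans (sym (ℕ.+-suc l d)) eq) p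
    ...   | inj₂ (p , _) = end true e , p

    hub-and-rim : Fin (order H) → ∃ (λ z → kind z ≡ 0) × ∃₂ (λ v l → kind v ≡ suc l)
    hub-and-rim v with kind v in eq
    ... | zero with leave 0 false (s≤s z≤n) eq (s≤s z≤n)
    ...   | e , _ , be = (v , eq) , end true e , spoke-in {e} be
    hub-and-rim v | suc l with leave 0 true (s≤s z≤n) eq (s≤s z≤n)
    ... | e , _ , be = (end false e , spoke-out {e} be) , v , l , eq

    -- The walk that follows hatted half-edges down the levels, starting with e.
    record Descent (q : ℕ) (e : Fin (size H)) : Set where
      field
        edge       : ℕ → Fin (size H)
        edge-top   : edge q ≡ e
        edge-bond  : ∀ {i} → i ≤ q → bondℕ (edge i) ≡ suc i
        edge-joint : ∀ {i} → i < q → end true (edge i) ≡ end false (edge (suc i))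

    descent : ∀ q {e} → q < K → bondℕ e ≡ suc q → Descent q e
    descent zero {e} q<K be = record
      { edge = λ _ → e ; edge-top = refl
      ; edge-bond = λ { z≤n → be } ; edge-joint = λ () }
    descent (suc q) {e} q<K be
      with leave (suc q) true (ℕ.m<n⇒m<1+n q<K) (out-kind {e} be)
             (ℕ.≤-trans (ℕ.≤-reflexive (sym (δ-refl q))) (ℕ.m≤m+n _ _))
    ... | e′ , joint , be′ = record
      { edge = edge ; edge-top = edge-hi (ℕ.n<1+n q) ; edge-bond = edge-bond
      ; edge-joint = edge-joint }
      where
      module D = Descent (descent q (ℕ.<⇒≤ q<K) be′)
      edge : ℕ → Fin (size H)
      edge i with i ℕ.≤? q
      ... | yes _ = D.edge i
      ... | no  _ = e
      edge-lo : ∀ {i} → i ≤ q → edge i ≡ D.edge i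
      edge-lo {i} i≤q with i ℕ.≤? q
      ... | yes _   = refl
      ... | no  i≰q = contradiction i≤q i≰q
      edge-hi : ∀ {i} → q < i → edge i ≡ e
      edge-hi {i} q<i with i ℕ.≤? q
      ... | yes i≤q = contradiction q<i (ℕ.≤⇒≯ i≤q)
      ... | no  _   = refl
      edge-bond : ∀ {i} → i ≤ suc q → bondℕ (edge i) ≡ suc i
      edge-bond i≤q with ℕ.m≤n⇒m<n∨m≡n i≤q
      ... | inj₁ i<q  = trans (cong bondℕ (edge-lo (ℕ.≤-pred i<q))) (D.edge-bond (ℕ.≤-pred i<q))
      ... | inj₂ refl = trans (cong bondℕ (edge-hi (ℕ.n<1+n q))) be
      edge-joint : ∀ {i} → i < suc q → end true (edge i) ≡ end false (edge (suc i))
      edge-joint i<q with ℕ.m≤n⇒m<n∨m≡n (ℕ.≤-pred i<q)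
      ... | inj₁ i<q′ rewrite edge-lo (ℕ.<⇒≤ i<q′) | edge-lo i<q′ = D.edge-joint i<q′
      ... | inj₂ refl rewrite edge-lo (ℕ.≤-refl {q}) | edge-hi (ℕ.n<1+n q) =
        trans (cong (end true) D.edge-top) joint

    TopEdges : Fin (order H) → Set
    TopEdges z = ∃₂ λ e f → e ≢ f × (end true e ≡ z × bondℕ e ≡ suc K′)
                                  × (end true f ≡ z × bondℕ f ≡ suc c)

    top-edges : ∀ z → kind z ≡ suc K → TopEdges z
    top-edges z kz with ℕ.m≤n⇒m<n∨m≡n c≤K′
    ... | inj₁ c<K′
      with leave (suc K′) true ℕ.≤-refl kz
             (ℕ.≤-trans (ℕ.≤-reflexive (sym (δ-refl K′))) (ℕ.m≤m+n _ _))
         | leave (suc c) true (s≤s c<K) kz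
             (ℕ.≤-trans (ℕ.≤-reflexive (sym (cong₂ _*_ (δ-refl K) (δ-refl c)))) (ℕ.m≤n+m _ _))
    ...   | e , pe , be | f , pf , bf = e , f ,
      (λ { refl → ℕ.<⇒≢ c<K′ (ℕ.suc-injective (trans (sym bf) be)) }) , (pe , be) , (pf , bf)
    top-edges z kz | inj₂ refl
      with two-half-edges z (suc (fromℕ< c<K)) true
        (subst (2 ≤_) (sym (trans (cong₂ (λ t a → labels t (suc a) true) kz (toℕ-fromℕ< c<K))
          (cong₂ _+_ (δ-refl K′) (cong₂ _*_ (δ-refl K) (δ-refl c))))) ℕ.≤-refl)
    ... | e , f , e≢f , (pe , be) , (pf , bf) = e , f , e≢f ,
      (pe , trans (cong toℕ be) (cong suc (toℕ-fromℕ< c<K))) ,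
      (pf , trans (cong toℕ bf) (cong suc (toℕ-fromℕ< c<K)))

    module Walk (H≤W : order H ≤ suc m) {η z} (kη : kind η ≡ 0) (kz : kind z ≡ suc K)
                (top : TopEdges z) where

      e₁ = proj₁ top
      e₂ = proj₁ (proj₂ top)

      e₁≢e₂ : e₁ ≢ e₂
      e₁≢e₂ = proj₁ (proj₂ (proj₂ top))

      z₁ : end true e₁ ≡ z
      z₁ = proj₁ (proj₁ (proj₂ (proj₂ (proj₂ top))))

      z₂ : end true e₂ ≡ z
      z₂ = proj₁ (proj₂ (proj₂ (proj₂ (proj₂ top))))

      module A = Descent (descent K′ ℕ.≤-refl (proj₂ (proj₁ (proj₂ (proj₂ (proj₂ top))))))
      module B = Descent (descent c c<K (proj₂ (proj₂ (proj₂ (proj₂ (proj₂ top))))))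

      tailA : ∀ {i} → i < K → kind (end false (A.edge i)) ≡ suc i
      tailA {i} i<K = out-kind {A.edge i} (A.edge-bond (ℕ.≤-pred i<K))

      tailB : ∀ {i} → i ≤ c → kind (end false (B.edge i)) ≡ suc i
      tailB {i} i≤c = out-kind {B.edge i} (B.edge-bond i≤c)

      tails-distinct : ∀ {i} → suc i ≤ c → A.edge (suc i) ≢ B.edge (suc i) →
                       end false (A.edge (suc i)) ≢ end false (B.edge (suc i))
      tails-distinct {i} i≤c A≢B eq = A≢B (unique false (tailB i≤c)
        (ℕ.≤-reflexive (trans (ℕ.+-identityʳ _) (δ-refl i)))
        eq (A.edge-bond (ℕ.≤-trans i≤c c≤K′)) refl (B.edge-bond i≤c))

      edges-distinct : ∀ d {i} → i + d ≡ c → A.edge i ≢ B.edge i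
      edges-distinct zero {i} i+0≡c eq with trans (sym (ℕ.+-identityʳ i)) i+0≡c
      ... | refl with ℕ.m≤n⇒m<n∨m≡n c≤K′
      ...   | inj₂ refl = e₁≢e₂ (trans (sym A.edge-top) (trans eq B.edge-top))
      ...   | inj₁ c<K′ = ℕ.<⇒≢ c<K′ (ℕ.suc-injective (ℕ.suc-injective (trans
        (sym (tailA (s≤s c<K′))) (trans (cong kind (trans (sym (A.edge-joint c<K′))
          (trans (cong (end true) (trans eq B.edge-top)) z₂))) kz))))
      edges-distinct (suc d) {i} i+d≡c eq =
        tails-distinct i<c (edges-distinct d (trans (sym (ℕ.+-suc i d)) i+d≡c))
          (trans (sym (A.edge-joint (ℕ.≤-trans i<c c≤K′)))
            (trans (cong (end true) eq) (B.edge-joint i<c)))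
        where
        i<c : i < c
        i<c = ℕ.m+n≤o⇒m≤o (suc i) (ℕ.≤-reflexive (trans (sym (ℕ.+-suc i d)) i+d≡c))

      A≢B : ∀ {i} → i ≤ c → A.edge i ≢ B.edge i
      A≢B i≤c = edges-distinct _ (ℕ.m+[n∸m]≡n i≤c)

      rimEdge : ℕ → Fin (size H)
      rimEdge p with p ℕ.<? K
      ... | yes _ = A.edge p
      ... | no  _ = B.edge ((K + c) ∸ p)

      rimEdge-lo : ∀ {p} → p < K → rimEdge p ≡ A.edge p
      rimEdge-lo {p} p<K with p ℕ.<? K
      ... | yes _   = refl
      ... | no  p≮K = contradiction p<K p≮K

      rimEdge-hi : ∀ {p} → K ≤ p → rimEdge p ≡ B.edge ((K + c) ∸ p)
      rimEdge-hi {p} K≤p with p ℕ.<? K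
      ... | yes p<K = contradiction p<K (ℕ.≤⇒≯ K≤p)
      ... | no  _   = refl

      w : ℕ → Fin (order H)
      w p = end (rimHat p) (rimEdge p)

      w-lo : ∀ {p} → p < K → w p ≡ end false (A.edge p)
      w-lo p<K = cong₂ end (rimHat-lo p<K) (rimEdge-lo p<K)

      w-hi : ∀ {p} → K ≤ p → w p ≡ end true (B.edge ((K + c) ∸ p))
      w-hi K≤p = cong₂ end (rimHat-hi K≤p) (rimEdge-hi K≤p)

      w-top : w K ≡ z
      w-top = trans (w-hi ℕ.≤-refl) (trans
        (cong (end true) (trans (cong B.edge (ℕ.m+n∸m≡n K c)) B.edge-top)) z₂)

      w-above : ∀ {p} → K < p → p < m → w p ≡ end false (B.edge (m ∸ p))
      w-above {p} K<p p<m = trans (w-hi (ℕ.<⇒≤ K<p))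
        (trans (B.edge-joint (subst (_≤ c) step (hi-level≤c K<p)))
          (cong (λ x → end false (B.edge x)) (sym step)))
        where
        step : m ∸ p ≡ suc ((K + c) ∸ p)
        step = ℕ.+-∸-assoc 1 {K + c} {p} (ℕ.≤-pred p<m)

      kind-w : ∀ {p} → p < m → kind (w p) ≡ suc (level p)
      kind-w {p} p<m with ℕ.<-cmp p K
      ... | tri< p<K _ _ = trans (cong kind (w-lo p<K))
        (trans (tailA p<K) (cong suc (sym (level-lo (ℕ.<⇒≤ p<K)))))
      ... | tri≈ _ refl _ = trans (cong kind w-top)
        (trans kz (cong suc (sym (level-lo (ℕ.≤-refl {K})))))
      ... | tri> _ _ K<p = trans (cong kind (w-above K<p p<m))
        (trans (tailB (hi-level≤c K<p)) (cong suc (sym (level-hi K<p))))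

      w-step : ∀ {p} → suc p < m → end (not (rimHat p)) (rimEdge p) ≡ w (suc p)
      w-step {p} p+1<m with ℕ.<-cmp (suc p) K
      ... | tri< p+1<K _ _ rewrite rimHat-lo (ℕ.<⇒≤ p+1<K) | rimEdge-lo (ℕ.<⇒≤ p+1<K) =
        trans (A.edge-joint (ℕ.≤-pred p+1<K)) (sym (w-lo p+1<K))
      ... | tri≈ _ refl _ rewrite rimHat-lo (ℕ.≤-refl {K}) | rimEdge-lo (ℕ.≤-refl {K}) =
        trans (cong (end true) A.edge-top) (trans z₁ (sym w-top))
      ... | tri> _ _ K<p+1 rewrite rimHat-hi (ℕ.≤-pred K<p+1) | rimEdge-hi (ℕ.≤-pred K<p+1) =
        sym (w-above K<p+1 p+1<m)

      lo≢hi : ∀ {p q} → p ≤ K → K < q → q < m → w p ≢ w q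
      lo≢hi {p} {q} p≤K K<q q<m eq = tails-distinct x<c (A≢B x<c)
        (trans (sym (trans (cong w p≡x) (w-lo (ℕ.≤-<-trans x<c c<K))))
          (trans eq (trans (w-above K<q q<m) (cong (λ x → end false (B.edge x)) step))))
        where
        x = (K + c) ∸ q
        step : m ∸ q ≡ suc x
        step = ℕ.+-∸-assoc 1 {K + c} {q} (ℕ.≤-pred q<m)
        x<c : suc x ≤ c
        x<c = subst (_≤ c) step (hi-level≤c K<q)
        p≡x : p ≡ suc x
        p≡x = ℕ.suc-injective (trans (cong suc (sym (level-lo p≤K))) (trans
          (sym (kind-w (s≤s (ℕ.≤-trans p≤K (ℕ.m≤m+n K c)))))
          (trans (cong kind eq) (trans (kind-w q<m) (cong suc (trans (level-hi K<q) step))))))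

      w-injective : ∀ {p q} → p < m → q < m → w p ≡ w q → p ≡ q
      w-injective {p} {q} p<m q<m eq with ℕ.≤-<-connex p K | ℕ.≤-<-connex q K
      ... | inj₁ p≤K | inj₂ K<q = contradiction eq (lo≢hi p≤K K<q q<m)
      ... | inj₂ K<p | inj₁ q≤K = contradiction (sym eq) (lo≢hi q≤K K<p p<m)
      ... | inj₁ p≤K | inj₁ q≤K = trans (sym (level-lo p≤K)) (trans
        (ℕ.suc-injective (trans (sym (kind-w p<m)) (trans (cong kind eq) (kind-w q<m))))
        (level-lo q≤K))
      ... | inj₂ K<p | inj₂ K<q = ℕ.∸-cancelˡ-≡ (ℕ.<⇒≤ p<m) (ℕ.<⇒≤ q<m)
        (trans (sym (level-hi K<p)) (trans
          (ℕ.suc-injective (trans (sym (kind-w p<m)) (trans (cong kind eq) (kind-w q<m))))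
          (level-hi K<q)))

      φ : Fin (suc m) → Fin (order H)
      φ zero    = η
      φ (suc i) = w (toℕ i)

      η≢w : ∀ {p} → p < m → η ≢ w p
      η≢w p<m eq with () ← trans (sym kη) (trans (cong kind eq) (kind-w p<m))

      φ-injective : Injective _≡_ _≡_ φ
      φ-injective {zero}  {zero}  eq = refl
      φ-injective {zero}  {suc j} eq = contradiction eq (η≢w (toℕ<n j))
      φ-injective {suc i} {zero}  eq = contradiction (sym eq) (η≢w (toℕ<n i))
      φ-injective {suc i} {suc j} eq =
        cong suc (toℕ-injective (w-injective (toℕ<n i) (toℕ<n j) eq))

      hub-unique : ∀ {v} → kind v ≡ 0 → v ≡ η
      hub-unique {v} kv with injective⇒surjective H≤W φ-injective v
      ... | zero  , eq = sym eq
      ... | suc i , eq with () ← trans (sym kv) (trans (cong kind (sym eq)) (kind-w (toℕ<n i)))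

      level≡0 : ∀ {p} → p < m → level p ≡ 0 → p ≡ 0
      level≡0 {p} p<m eq with ℕ.≤-<-connex p K
      ... | inj₁ p≤K = trans (sym (level-lo p≤K)) eq
      ... | inj₂ K<p = contradiction (trans (sym (level-hi K<p)) eq) (ℕ.m>n⇒m∸n≢0 p<m)

      bottom-unique : ∀ {v} → kind v ≡ 1 → v ≡ w 0
      bottom-unique {v} kv with injective⇒surjective H≤W φ-injective v
      ... | zero  , eq with () ← trans (sym kη) (trans (cong kind eq) kv)
      ... | suc i , eq = trans (sym eq) (cong w (level≡0 (toℕ<n i)
        (ℕ.suc-injective (trans (sym (kind-w (toℕ<n i))) (trans (cong kind eq) kv)))))

      w-close : end (not (rimHat (K + c))) (rimEdge (K + c)) ≡ w 0
      w-close rewrite rimHat-hi (ℕ.m≤m+n K c) | rimEdge-hi (ℕ.m≤m+n K c) | ℕ.n∸n≡0 (K + c) =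
        bottom-unique (tailB z≤n)

      w-next : ∀ i → end (not (rimHat (toℕ i))) (rimEdge (toℕ i)) ≡ w (toℕ (cnext {m} i))
      w-next i with cnext-cases i
      ... | inj₁ p = trans (w-step (subst (_< m) p (toℕ<n (cnext i)))) (cong w (sym p))
      ... | inj₂ (p , q) rewrite p | ℕ.suc-injective q = w-close

      bond-rim : ∀ p → bondℕ (rimEdge p) ≡ suc (rimBond p)
      bond-rim p with ℕ.<-≤-connex p K
      ... | inj₁ p<K rewrite rimEdge-lo p<K | rimBond-lo p<K = A.edge-bond (ℕ.≤-pred p<K)
      ... | inj₂ K≤p rewrite rimEdge-hi K≤p | rimBond-hi K≤p = B.edge-bond (hi-bond≤c K≤p)

      A-side≢B-side : ∀ {p q} → p < K → K ≤ q → rimEdge p ≢ rimEdge q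
      A-side≢B-side {p} {q} p<K K≤q eq = A≢B (hi-bond≤c K≤q)
        (trans (cong A.edge (sym p≡x)) (trans (sym (rimEdge-lo p<K))
          (trans eq (rimEdge-hi K≤q))))
        where
        p≡x : p ≡ (K + c) ∸ q
        p≡x = trans (sym (rimBond-lo p<K)) (trans
          (ℕ.suc-injective (trans (sym (bond-rim p)) (trans (cong bondℕ eq) (bond-rim q))))
          (rimBond-hi K≤q))

      rimEdge-injective : ∀ {p q} → p < m → q < m → rimEdge p ≡ rimEdge q → p ≡ q
      rimEdge-injective {p} {q} p<m q<m eq with ℕ.<-≤-connex p K | ℕ.<-≤-connex q K
      ... | inj₁ p<K | inj₂ K≤q = contradiction eq (A-side≢B-side p<K K≤q)
      ... | inj₂ K≤p | inj₁ q<K = contradiction (sym eq) (A-side≢B-side q<K K≤p)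
      ... | inj₁ p<K | inj₁ q<K = trans (sym (rimBond-lo p<K)) (trans
        (ℕ.suc-injective (trans (sym (bond-rim p)) (trans (cong bondℕ eq) (bond-rim q))))
        (rimBond-lo q<K))
      ... | inj₂ K≤p | inj₂ K≤q = ℕ.∸-cancelˡ-≡ (ℕ.≤-pred p<m) (ℕ.≤-pred q<m)
        (trans (sym (rimBond-hi K≤p)) (trans
          (ℕ.suc-injective (trans (sym (bond-rim p)) (trans (cong bondℕ eq) (bond-rim q))))
          (rimBond-hi K≤q)))

      spokeAt : ∀ (i : Fin m) → ∃ λ e → end true e ≡ w (toℕ i) × bondℕ e ≡ 0
      spokeAt i = leave 0 true (s≤s z≤n) (kind-w (toℕ<n i)) (s≤s z≤n)

      ψ : Fin (m + m) → Fin (size H)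
      ψ e = [ (λ i → proj₁ (spokeAt i)) , (λ i → rimEdge (toℕ i)) ]′ (splitAt m e)

      ψ-spoke : ∀ i → ψ (i ↑ˡ m) ≡ proj₁ (spokeAt i)
      ψ-spoke i rewrite splitAt-↑ˡ m i m = refl

      ψ-rim : ∀ i → ψ (m ↑ʳ i) ≡ rimEdge (toℕ i)
      ψ-rim i rewrite splitAt-↑ʳ m m i = refl

      spoke≢rimEdge : ∀ i p → proj₁ (spokeAt i) ≢ rimEdge p
      spoke≢rimEdge i p eq
        with () ← trans (sym (proj₂ (proj₂ (spokeAt i)))) (trans (cong bondℕ eq) (bond-rim p))

      ψ-injective : Injective _≡_ _≡_ ψ
      ψ-injective {e} {f} eq with wheelEdge m e | wheelEdge m f
      ... | spoke i | spoke j = cong (_↑ˡ m) (toℕ-injective (w-injective (toℕ<n i) (toℕ<n j)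
        (trans (sym (proj₁ (proj₂ (spokeAt i)))) (trans
          (cong (end true) (trans (sym (ψ-spoke i)) (trans eq (ψ-spoke j))))
          (proj₁ (proj₂ (spokeAt j)))))))
      ... | spoke i | rim j = contradiction
        (trans (sym (ψ-spoke i)) (trans eq (ψ-rim j))) (spoke≢rimEdge i (toℕ j))
      ... | rim i | spoke j = contradiction
        (trans (sym (ψ-spoke j)) (trans (sym eq) (ψ-rim i))) (spoke≢rimEdge j (toℕ i))
      ... | rim i | rim j = cong (m ↑ʳ_) (toℕ-injective (rimEdge-injective (toℕ<n i) (toℕ<n j)
        (trans (sym (ψ-rim i)) (trans eq (ψ-rim j)))))

      same-tile : ∀ v → tileOf (φ v) ≡ wheelTile v
      same-tile zero    = toℕ-injective kη
      same-tile (suc i) = toℕ-injective (trans (kind-w (toℕ<n i)) (sym (toℕ-wheelTile i)))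

      same-end : ∀ h e → end h (ψ e) ≡ φ (labelled (wheelHat e) h (wheelEnds m e))
      same-end h e with wheelEdge m e
      ... | spoke i rewrite ψ-spoke i | wheelEnd-spoke h i with h
      ...   | false = hub-unique (spoke-out {proj₁ (spokeAt i)} (proj₂ (proj₂ (spokeAt i))))
      ...   | true  = proj₁ (proj₂ (spokeAt i))
      same-end h e | rim i rewrite ψ-rim i | wheelEnd-rim h i =
        at (rimHat (toℕ i)) h refl (w-next i)
        where
        at : ∀ l h → w (toℕ i) ≡ end l (rimEdge (toℕ i)) →
             end (not l) (rimEdge (toℕ i)) ≡ w (toℕ (cnext i)) →
             end h (rimEdge (toℕ i)) ≡ φ (labelled l h (suc i , suc (cnext i)))
        at false false p q = sym p
        at false true  p q = q
        at true  false p q = q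
        at true  true  p q = sym p

      isomorphism : H ≅ W
      isomorphism = embedding⇒≅ wheel-realization S H≤W φ φ-injective ψ ψ-injective
        same-tile same-end

    realized⇒≅ : 1 ≤ order H → order H ≤ suc m → H ≅ W
    realized⇒≅ 1≤H H≤W with hub-and-rim (fromℕ< 1≤H)
    ... | (η , kη) , v , l , kv with climb (K ∸ l) (ℕ.m+[n∸m]≡n (kind≤ v kv)) kv
    ...   | z , kz = Walk.isomorphism H≤W kη kz (top-edges z kz)

wheel-admissible : ∀ K′ c (c≤K′ : c ≤ K′) →
  Admissible3 (WheelPot.pot K′ c c≤K′) (wheel (suc (suc (suc K′ + c))))
wheel-admissible K′ c c≤K′ = WheelPot.wheel-realization K′ c c≤K′ , minimal
  where
  minimal : ∀ H → 1 ≤ order H → Realization (WheelPot.pot K′ c c≤K′) H →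
    suc (suc (suc K′ + c)) < order H ⊎ H ≅ wheel (suc (suc (suc K′ + c)))
  minimal H 1≤H S with ℕ.≤-<-connex (order H) (suc (suc (suc K′ + c)))
  ... | inj₁ H≤W = inj₂ (Uniqueness.realized⇒≅ K′ c c≤K′ S 1≤H H≤W)
  ... | inj₂ W<H = inj₁ W<H

wheel-B3 : ∀ K′ c → c ≤ K′ → K′ ≤ suc c → 4 ≤ suc (suc K′ + c) →
           IsB3 (wheel (suc (suc (suc K′ + c)))) (suc (suc K′))
wheel-B3 K′ c c≤K′ K′≤1+c 4≤m =
  (WheelPot.pot K′ c c≤K′ , wheel-admissible K′ c c≤K′) , lower
  where
  open ℕ.≤-Reasoning
  lower : ∀ k (P : Pot k) → Admissible3 P _ → suc (suc K′) ≤ k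
  lower k P adm with LowerBound.bound 4≤m P adm
  ... | inj₁ m≤k = ℕ.≤-trans (s≤s (s≤s (ℕ.m≤m+n K′ c))) m≤k
  ... | inj₂ 2+m≤2k = ℕ.*-cancelʳ-< 2 (suc K′) k (begin-strict
    suc K′ * 2             ≡⟨ ℕ.*-comm (suc K′) 2 ⟩
    suc K′ + (suc K′ + 0)  ≡⟨ cong (suc K′ +_) (ℕ.+-identityʳ (suc K′)) ⟩
    suc K′ + suc K′        ≤⟨ ℕ.+-monoʳ-≤ (suc K′) (s≤s K′≤1+c) ⟩
    suc K′ + suc (suc c)   ≡⟨ ℕ.+-suc (suc K′) (suc c) ⟩
    suc (suc K′ + suc c)   ≡⟨ cong suc (ℕ.+-suc (suc K′) c) ⟩
    suc (suc (suc K′ + c)) <⟨ ℕ.n<1+n _ ⟩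
    suc (suc (suc (suc K′ + c))) ≤⟨ 2+m≤2k ⟩
    k * 2                  ∎)

wheel-B3-by-remainder : ∀ K r → r < 2 → 4 < r + K * 2 → IsB3 (wheel (r + K * 2)) (K + 1)
wheel-B3-by-remainder zero          r r<2 4<n = contradiction
  (subst (_< 2) (sym (ℕ.+-identityʳ r)) r<2) (ℕ.≤⇒≯ (ℕ.<⇒≤ (ℕ.<-trans (s≤s (s≤s (s≤s z≤n))) 4<n)))
wheel-B3-by-remainder (suc zero)    r r<2 4<n = contradiction
  (ℕ.≤-trans 4<n (ℕ.+-monoˡ-≤ 2 (ℕ.<⇒≤ r<2))) ℕ.1+n≰n
wheel-B3-by-remainder (suc (suc K)) r r<2 4<n =
  subst₂ (λ n k → IsB3 (wheel n) k) (sym n≡) (ℕ.+-comm 1 (2 + K))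
    (wheel-B3 (suc K) (r + K) (ℕ.+-monoˡ-≤ K (ℕ.≤-pred r<2)) (s≤s (ℕ.m≤n+m K r))
      (ℕ.≤-pred (subst (4 <_) n≡ 4<n)))
  where
  n≡ : r + (2 + K) * 2 ≡ 2 + (2 + K + (r + K))
  n≡ = solve 2 (λ r K → r :+ (con 2 :+ K) :* con 2 := con 2 :+ (con 2 :+ K :+ (r :+ K))) refl r K

theorem3 : ∀ (n : ℕ) → 4 < n → IsB3 (wheel n) (n / 2 + 1)
theorem3 n 4<n = subst (λ x → IsB3 (wheel x) (n / 2 + 1)) (sym (m≡m%n+[m/n]*n n 2))
  (wheel-B3-by-remainder (n / 2) (n % 2) (m%n<n n 2)
    (subst (4 <_) (m≡m%n+[m/n]*n n 2) 4<n))
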